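{- Let $r\ge 1$. Let $X$ be a simplicial complex in which every $(r-1)$-dimensional simplex is contained in exactly one $r$-dimensional simplex. Then, for all $1\le k\le f_{r-1}(X)/(r+1)$, \[ \sum_{i=1}^k \lambda_i(L_{r-1}^+(X)) = (r+1)k = \sum_{i=1}^{(r+1)k} d_i^{(r)}(X). \]
   Context: A simplicial complex $X$ on a finite vertex set $V$ is a family of subsets of $V$ closed under inclusion; its elements are called simplices (or faces), $\dim(\sigma)=|\sigma|-1$ for $\sigma\in X$, and $\dim(X)$ is the maximal dimension of a simplex. $X(i)$ is the set of $i$-dimensional simplices (with $X(-1)=\{\emptyset\}$) and $f_i(X)=|X(i)|$. For $\sigma\in X$ and $1\le r\le\dim(X)$, the $r$-degree $\deg_X^{(r)}(\sigma)$ is the number of $r$-dimensional simplices of $X$ containing $\sigma$. For $1\le i\le f_{r-1}(X)$, $d_i^{(r)}(X)$ is the $i$-th largest (with multiplicity) $r$-degree of a simplex in $X(r-1)$. Fix an arbitrary linear order $<$ on $V$. For $\sigma\in X(s-1)$, $\tau\in X(s)$ with $\sigma\subset\tau$ ($0\le s\le \dim(X)$), let $u$ be the unique vertex of $\tau\setminus\sigma$ and set $(\tau:\sigma)=(-1)^{|\{v\in\tau:\,v<u\}|}$. For $1\le r\le\dim(X)$, the upper Laplacian $L_{r-1}^+(X)\in\mathbb{R}^{f_{r-1}(X)\times f_{r-1}(X)}$ is the matrix indexed by $X(r-1)$ with $L_{r-1}^+(X)_{\tau,\tau}=\deg_X^{(r)}(\tau)$; $L_{r-1}^+(X)_{\tau,\eta}=-(\tau:\tau\cap\eta)(\eta:\tau\cap\eta)$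 if $|\tau\cap\eta|=r-1$ and $\tau\cup\eta\in X$; and all other entries $0$. For a symmetric real matrix $M$, $\lambda_i(M)$ is its $i$-th largest eigenvalue (with multiplicity). -}

module Defs where

open import Algebra.Bundles using (CommutativeRing)
open import Data.Bool.Base using (if_then_else_)
open import Data.Fin.Base as Fin using (Fin)
open import Data.Fin.Properties as Fin using (any?)
open import Data.Fin.Subset using (Subset; inside; outside; _∈_; _⊆_; _∩_; _∪_; _─_; ∣_∣)
open import Data.Fin.Subset.Properties using (_∈?_; _⊆?_)
open import Data.Integer.Base as ℤ using (ℤ; +_; -1ℤ; 0ℤ)
open import Data.List.Base as List using (List; []; _∷_; _++_; length; filter; lookup; allFin)
import Data.List.Sort as Sort
open import Data.Nat.Base as ℕ using (ℕ; zero; suc)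
import Data.Nat.Properties as ℕ
open import Data.Product.Base using (_×_; _,_; ∃; ∃-syntax; proj₁; proj₂)
open import Data.Rational.Base as ℚ using (ℚ; 0ℚ; 1ℚ; ½)
import Data.Rational.Properties as ℚ
open import Data.Rational.Solver using (module +-*-Solver)
open import Data.Vec.Base using ([]; _∷_)
open import Data.Vec.Functional as Vector using (Vector)
open import Function.Base using (_∘_)
open import Function.Bundles using (_⇔_)
open import Level using (0ℓ)
open import Relation.Binary.Core using (Rel)
open import Relation.Binary.Structures using (IsStrictTotalOrder)
open import Relation.Binary.PropositionalEquality
import Relation.Binary.Construct.Flip.EqAndOrd as Flip
open import Relation.Nullary.Decidable using (Dec; yes; no; does; _×-dec_)
open import Relation.Unary using (Pred; Decidable)

-- Real numbers are Cauchy sequences of rationals, with setoid equality _≃_.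

IsCauchy : (ℕ → ℚ) → Set
IsCauchy a = ∀ ε → 0ℚ ℚ.< ε →
  ∃[ N ] ∀ m n → N ℕ.≤ m → N ℕ.≤ n → ℚ.∣ a m ℚ.- a n ∣ ℚ.< ε

record ℝ : Set where
  constructor mkℝ
  field
    seq    : ℕ → ℚ
    cauchy : IsCauchy seq

open ℝ public

infix 4 _≃_ _≤ᴿ_

_≃_ : Rel ℝ 0ℓ
x ≃ y = ∀ ε → 0ℚ ℚ.< ε → ∃[ N ] ∀ n → N ℕ.≤ n → ℚ.∣ seq x n ℚ.- seq y n ∣ ℚ.< ε

_≤ᴿ_ : Rel ℝ 0ℓ
x ≤ᴿ y = ∀ ε → 0ℚ ℚ.< ε → ∃[ N ] ∀ n → N ℕ.≤ n → seq x n ℚ.< seq y n ℚ.+ ε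

halve : ∀ ε → 0ℚ ℚ.< ε → 0ℚ ℚ.< ½ ℚ.* ε
halve ε 0<ε = subst (ℚ._< ½ ℚ.* ε) (ℚ.*-zeroʳ ½) (ℚ.*-monoʳ-<-pos ½ 0<ε)

halves : ∀ ε → ½ ℚ.* ε ℚ.+ ½ ℚ.* ε ≡ ε
halves ε = trans (sym (ℚ.*-distribʳ-+ ε ½ ½)) (ℚ.*-identityˡ ε)

∣+∣< : ∀ {a b ε} → ℚ.∣ a ∣ ℚ.< ½ ℚ.* ε → ℚ.∣ b ∣ ℚ.< ½ ℚ.* ε → ℚ.∣ a ℚ.+ b ∣ ℚ.< ε
∣+∣< {a} {b} {ε} p q = subst (ℚ.∣ a ℚ.+ b ∣ ℚ.<_) (halves ε)
  (ℚ.≤-<-trans (ℚ.∣p+q∣≤∣p∣+∣q∣ a b) (ℚ.+-mono-< p q))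

shrink : ∀ B ε → 0ℚ ℚ.< B → 0ℚ ℚ.< ε → ∃[ δ ] 0ℚ ℚ.< δ × B ℚ.* δ ≡ ε
shrink B ε 0<B 0<ε = 1/B ℚ.* ε , 0<δ , (begin
    B ℚ.* (1/B ℚ.* ε)  ≡⟨ sym (ℚ.*-assoc B 1/B ε) ⟩
    (B ℚ.* 1/B) ℚ.* ε  ≡⟨ cong (ℚ._* ε) (ℚ.*-inverseʳ B) ⟩
    1ℚ ℚ.* ε           ≡⟨ ℚ.*-identityˡ ε ⟩
    ε                  ∎)
  where
  open ≡-Reasoning
  instance
    B-pos : ℚ.Positive B
    B-pos = ℚ.positive 0<B
    B-nz : ℚ.NonZero B
    B-nz = ℚ.pos⇒nonZero B
  1/B : ℚ
  1/B = ℚ.1/ B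
  instance
    1/B-pos : ℚ.Positive 1/B
    1/B-pos = ℚ.1/pos⇒pos B
  0<δ : 0ℚ ℚ.< 1/B ℚ.* ε
  0<δ = subst (ℚ._< 1/B ℚ.* ε) (ℚ.*-zeroʳ 1/B) (ℚ.*-monoʳ-<-pos 1/B 0<ε)

∣*∣< : ∀ {a b B δ} → 0ℚ ℚ.< B → ℚ.∣ a ∣ ℚ.< B → ℚ.∣ b ∣ ℚ.< δ → ℚ.∣ a ℚ.* b ∣ ℚ.< B ℚ.* δ
∣*∣< {a} {b} {B} {δ} 0<B p q = begin-strict
  ℚ.∣ a ℚ.* b ∣        ≡⟨ ℚ.∣p*q∣≡∣p∣*∣q∣ a b ⟩
  ℚ.∣ a ∣ ℚ.* ℚ.∣ b ∣  ≤⟨ ℚ.*-monoʳ-≤-nonNeg ℚ.∣ b ∣ {{ℚ.nonNegative (ℚ.0≤∣p∣ b)}} (ℚ.<⇒≤ p) ⟩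
  B ℚ.* ℚ.∣ b ∣        <⟨ ℚ.*-monoʳ-<-pos B {{ℚ.positive 0<B}} q ⟩
  B ℚ.* δ              ∎
  where open ℚ.≤-Reasoning

∣-∣-comm : ∀ a b → ℚ.∣ a ℚ.- b ∣ ≡ ℚ.∣ b ℚ.- a ∣
∣-∣-comm a b = trans (sym (ℚ.∣-p∣≡∣p∣ (a ℚ.- b))) (cong ℚ.∣_∣
  (solve 2 (λ a b → :- (a :- b) := b :- a) refl a b))
  where open +-*-Solver

bounded : ∀ x → ∃[ B ] 0ℚ ℚ.< B × ∃[ N ] ∀ n → N ℕ.≤ n → ℚ.∣ seq x n ∣ ℚ.< B
bounded x with cauchy x 1ℚ (ℚ.positive⁻¹ 1ℚ)
... | N , close = 1ℚ ℚ.+ c , 0<B , N , λ n N≤n → begin-strict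
    ℚ.∣ seq x n ∣
      ≡⟨ cong ℚ.∣_∣ (solve 2 (λ a b → a := (a :- b) :+ b) refl (seq x n) (seq x N)) ⟩
    ℚ.∣ (seq x n ℚ.- seq x N) ℚ.+ seq x N ∣
      ≤⟨ ℚ.∣p+q∣≤∣p∣+∣q∣ (seq x n ℚ.- seq x N) (seq x N) ⟩
    ℚ.∣ seq x n ℚ.- seq x N ∣ ℚ.+ c
      <⟨ ℚ.+-monoˡ-< c (close n N N≤n ℕ.≤-refl) ⟩
    1ℚ ℚ.+ c ∎
  where
  open ℚ.≤-Reasoning
  open +-*-Solver
  c : ℚ
  c = ℚ.∣ seq x N ∣
  0<B : 0ℚ ℚ.< 1ℚ ℚ.+ c
  0<B = ℚ.+-mono-<-≤ (ℚ.positive⁻¹ 1ℚ) (ℚ.0≤∣p∣ (seq x N))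

absorb : ∀ x ε → 0ℚ ℚ.< ε → ∃[ δ ] 0ℚ ℚ.< δ ×
  ∃[ N ] ∀ n → N ℕ.≤ n → ∀ b → ℚ.∣ b ∣ ℚ.< δ → ℚ.∣ seq x n ℚ.* b ∣ ℚ.< ε
absorb x ε 0<ε =
  let B , 0<B , N , ∣x∣<B = bounded x
      δ , 0<δ , Bδ≡ε = shrink B ε 0<B 0<ε
  in δ , 0<δ , N , λ n N≤n b ∣b∣<δ →
    subst (ℚ.∣ seq x n ℚ.* b ∣ ℚ.<_) Bδ≡ε (∣*∣< 0<B (∣x∣<B n N≤n) ∣b∣<δ)

+-split : ∀ a b c d → (a ℚ.+ b) ℚ.- (c ℚ.+ d) ≡ (a ℚ.- c) ℚ.+ (b ℚ.- d)
+-split = solve 4 (λ a b c d → (a :+ b) :- (c :+ d) := (a :- c) :+ (b :- d)) refl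
  where open +-*-Solver

*-split : ∀ a b c d → (a ℚ.* b) ℚ.- (c ℚ.* d) ≡ a ℚ.* (b ℚ.- d) ℚ.+ d ℚ.* (a ℚ.- c)
*-split = solve 4 (λ a b c d → (a :* b) :- (c :* d) := a :* (b :- d) :+ d :* (a :- c)) refl
  where open +-*-Solver

neg-split : ∀ a c → (ℚ.- a) ℚ.- (ℚ.- c) ≡ c ℚ.- a
neg-split = solve 2 (λ a c → (:- a) :- (:- c) := c :- a) refl
  where open +-*-Solver

≃-refl : ∀ {x} → x ≃ x
≃-refl {x} ε 0<ε = 0 , λ n _ →
  subst (ℚ._< ε) (cong ℚ.∣_∣ (sym (ℚ.+-inverseʳ (seq x n)))) 0<ε

≃-sym : ∀ {x y} → x ≃ y → y ≃ x
≃-sym {x} {y} p ε 0<ε with p ε 0<ε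
... | N , close = N , λ n N≤n →
  subst (ℚ._< ε) (∣-∣-comm (seq x n) (seq y n)) (close n N≤n)

≃-trans : ∀ {x y z} → x ≃ y → y ≃ z → x ≃ z
≃-trans {x} {y} {z} p q ε 0<ε with p (½ ℚ.* ε) (halve ε 0<ε) | q (½ ℚ.* ε) (halve ε 0<ε)
... | M , close₁ | N , close₂ = M ℕ.⊔ N , λ n M⊔N≤n →
  subst (ℚ._< ε)
    (cong ℚ.∣_∣ (solve 3 (λ a b c → (a :- b) :+ (b :- c) := a :- c) refl (seq x n) (seq y n) (seq z n)))
    (∣+∣< (close₁ n (ℕ.m⊔n≤o⇒m≤o M N M⊔N≤n)) (close₂ n (ℕ.m⊔n≤o⇒n≤o M N M⊔N≤n)))
  where open +-*-Solver

≗⇒≃ : ∀ {x y} → (∀ n → seq x n ≡ seq y n) → x ≃ y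
≗⇒≃ {x} {y} eq ε 0<ε = 0 , λ n _ → subst (ℚ._< ε)
  (cong ℚ.∣_∣ (sym (trans (cong (ℚ._- seq y n) (eq n)) (ℚ.+-inverseʳ (seq y n))))) 0<ε

fromℚ : ℚ → ℝ
fromℚ q = mkℝ (λ _ → q) λ ε 0<ε → 0 , λ _ _ _ _ →
  subst (ℚ._< ε) (cong ℚ.∣_∣ (sym (ℚ.+-inverseʳ q))) 0<ε

fromℤ : ℤ → ℝ
fromℤ z = fromℚ (z ℚ./ 1)

fromℕ : ℕ → ℝ
fromℕ n = fromℤ (+ n)

0ᴿ 1ᴿ : ℝ
0ᴿ = fromℚ 0ℚ
1ᴿ = fromℚ 1ℚ

infixl 6 _+ᴿ_
infixl 7 _*ᴿ_
infix  8 -ᴿ_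

_+ᴿ_ : ℝ → ℝ → ℝ
x +ᴿ y = mkℝ (λ n → seq x n ℚ.+ seq y n) go
  where
  go : IsCauchy (λ n → seq x n ℚ.+ seq y n)
  go ε 0<ε with cauchy x (½ ℚ.* ε) (halve ε 0<ε) | cauchy y (½ ℚ.* ε) (halve ε 0<ε)
  ... | M , close₁ | N , close₂ = M ℕ.⊔ N , λ m n p q →
    subst (λ t → ℚ.∣ t ∣ ℚ.< ε) (sym (+-split (seq x m) (seq y m) (seq x n) (seq y n)))
      (∣+∣< (close₁ m n (ℕ.m⊔n≤o⇒m≤o M N p) (ℕ.m⊔n≤o⇒m≤o M N q))
            (close₂ m n (ℕ.m⊔n≤o⇒n≤o M N p) (ℕ.m⊔n≤o⇒n≤o M N q)))

-ᴿ_ : ℝ → ℝ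
-ᴿ x = mkℝ (λ n → ℚ.- seq x n) go
  where
  go : IsCauchy (λ n → ℚ.- seq x n)
  go ε 0<ε with cauchy x ε 0<ε
  ... | N , close = N , λ m n p q →
    subst (λ t → ℚ.∣ t ∣ ℚ.< ε) (sym (neg-split (seq x m) (seq x n))) (close n m q p)

_*ᴿ_ : ℝ → ℝ → ℝ
x *ᴿ y = mkℝ (λ n → seq x n ℚ.* seq y n) go
  where
  go : IsCauchy (λ n → seq x n ℚ.* seq y n)
  go ε 0<ε =
    let α , 0<α , K , x-absorbs = absorb x (½ ℚ.* ε) (halve ε 0<ε)
        β , 0<β , L , y-absorbs = absorb y (½ ℚ.* ε) (halve ε 0<ε)
        M , y-close = cauchy y α 0<α
        N , x-close = cauchy x β 0<β
    in (K ℕ.⊔ L) ℕ.⊔ (M ℕ.⊔ N) , λ m n p q →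
      let KL≤m = ℕ.m⊔n≤o⇒m≤o (K ℕ.⊔ L) (M ℕ.⊔ N) p
          KL≤n = ℕ.m⊔n≤o⇒m≤o (K ℕ.⊔ L) (M ℕ.⊔ N) q
          MN≤m = ℕ.m⊔n≤o⇒n≤o (K ℕ.⊔ L) (M ℕ.⊔ N) p
          MN≤n = ℕ.m⊔n≤o⇒n≤o (K ℕ.⊔ L) (M ℕ.⊔ N) q
      in subst (λ t → ℚ.∣ t ∣ ℚ.< ε) (sym (*-split (seq x m) (seq y m) (seq x n) (seq y n)))
        (∣+∣<
          (x-absorbs m (ℕ.m⊔n≤o⇒m≤o K L KL≤m) (seq y m ℚ.- seq y n)
            (y-close m n (ℕ.m⊔n≤o⇒m≤o M N MN≤m) (ℕ.m⊔n≤o⇒m≤o M N MN≤n)))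
          (y-absorbs n (ℕ.m⊔n≤o⇒n≤o K L KL≤n) (seq x m ℚ.- seq x n)
            (x-close m n (ℕ.m⊔n≤o⇒n≤o M N MN≤m) (ℕ.m⊔n≤o⇒n≤o M N MN≤n))))

+ᴿ-cong : ∀ {x x′ y y′} → x ≃ x′ → y ≃ y′ → x +ᴿ y ≃ x′ +ᴿ y′
+ᴿ-cong {x} {x′} {y} {y′} p q ε 0<ε =
  let M , x-close = p (½ ℚ.* ε) (halve ε 0<ε)
      N , y-close = q (½ ℚ.* ε) (halve ε 0<ε)
  in M ℕ.⊔ N , λ n r →
    subst (λ t → ℚ.∣ t ∣ ℚ.< ε) (sym (+-split (seq x n) (seq y n) (seq x′ n) (seq y′ n)))
      (∣+∣< (x-close n (ℕ.m⊔n≤o⇒m≤o M N r)) (y-close n (ℕ.m⊔n≤o⇒n≤o M N r)))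

-ᴿ-cong : ∀ {x x′} → x ≃ x′ → -ᴿ x ≃ -ᴿ x′
-ᴿ-cong {x} {x′} p ε 0<ε =
  let N , close = ≃-sym {x} {x′} p ε 0<ε
  in N , λ n r →
    subst (λ t → ℚ.∣ t ∣ ℚ.< ε) (sym (neg-split (seq x n) (seq x′ n))) (close n r)

*ᴿ-cong : ∀ {x x′ y y′} → x ≃ x′ → y ≃ y′ → x *ᴿ y ≃ x′ *ᴿ y′
*ᴿ-cong {x} {x′} {y} {y′} p q ε 0<ε =
  let α , 0<α , K , x-absorbs = absorb x (½ ℚ.* ε) (halve ε 0<ε)
      β , 0<β , L , y′-absorbs = absorb y′ (½ ℚ.* ε) (halve ε 0<ε)
      M , y-close = q α 0<α
      N , x-close = p β 0<β
  in (K ℕ.⊔ L) ℕ.⊔ (M ℕ.⊔ N) , λ n r →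
    let KL≤n = ℕ.m⊔n≤o⇒m≤o (K ℕ.⊔ L) (M ℕ.⊔ N) r
        MN≤n = ℕ.m⊔n≤o⇒n≤o (K ℕ.⊔ L) (M ℕ.⊔ N) r
    in subst (λ t → ℚ.∣ t ∣ ℚ.< ε) (sym (*-split (seq x n) (seq y n) (seq x′ n) (seq y′ n)))
      (∣+∣<
        (x-absorbs n (ℕ.m⊔n≤o⇒m≤o K L KL≤n) (seq y n ℚ.- seq y′ n)
          (y-close n (ℕ.m⊔n≤o⇒m≤o M N MN≤n)))
        (y′-absorbs n (ℕ.m⊔n≤o⇒n≤o K L KL≤n) (seq x n ℚ.- seq x′ n)
          (x-close n (ℕ.m⊔n≤o⇒n≤o M N MN≤n))))

ℝ-commutativeRing : CommutativeRing 0ℓ 0ℓ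
ℝ-commutativeRing = record
  { Carrier = ℝ ; _≈_ = _≃_ ; _+_ = _+ᴿ_ ; _*_ = _*ᴿ_ ; -_ = -ᴿ_ ; 0# = 0ᴿ ; 1# = 1ᴿ
  ; isCommutativeRing = record
    { isRing = record
      { +-isAbelianGroup = record
        { isGroup = record
          { isMonoid = record
            { isSemigroup = record
              { isMagma = record
                { isEquivalence = record
                  { refl  = λ {x} → ≃-refl {x}
                  ; sym   = λ {x y} → ≃-sym {x} {y}
                  ; trans = λ {x y z} → ≃-trans {x} {y} {z} }
                ; ∙-cong = λ {x y u v} → +ᴿ-cong {x} {y} {u} {v} }
              ; assoc = λ x y z → ≗⇒≃ {(x +ᴿ y) +ᴿ z} {x +ᴿ (y +ᴿ z)}
                  λ n → ℚ.+-assoc (seq x n) (seq y n) (seq z n) }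
            ; identity = (λ x → ≗⇒≃ {0ᴿ +ᴿ x} {x} λ n → ℚ.+-identityˡ (seq x n))
                       , (λ x → ≗⇒≃ {x +ᴿ 0ᴿ} {x} λ n → ℚ.+-identityʳ (seq x n)) }
          ; inverse = (λ x → ≗⇒≃ {(-ᴿ x) +ᴿ x} {0ᴿ} λ n → ℚ.+-inverseˡ (seq x n))
                    , (λ x → ≗⇒≃ {x +ᴿ -ᴿ x} {0ᴿ} λ n → ℚ.+-inverseʳ (seq x n))
          ; ⁻¹-cong = λ {x y} → -ᴿ-cong {x} {y} }
        ; comm = λ x y → ≗⇒≃ {x +ᴿ y} {y +ᴿ x} λ n → ℚ.+-comm (seq x n) (seq y n) }
      ; *-cong = λ {x y u v} → *ᴿ-cong {x} {y} {u} {v}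
      ; *-assoc = λ x y z → ≗⇒≃ {(x *ᴿ y) *ᴿ z} {x *ᴿ (y *ᴿ z)}
          λ n → ℚ.*-assoc (seq x n) (seq y n) (seq z n)
      ; *-identity = (λ x → ≗⇒≃ {1ᴿ *ᴿ x} {x} λ n → ℚ.*-identityˡ (seq x n))
                   , (λ x → ≗⇒≃ {x *ᴿ 1ᴿ} {x} λ n → ℚ.*-identityʳ (seq x n))
      ; distrib = (λ x y z → ≗⇒≃ {x *ᴿ (y +ᴿ z)} {x *ᴿ y +ᴿ x *ᴿ z}
                     λ n → ℚ.*-distribˡ-+ (seq x n) (seq y n) (seq z n))
                , (λ x y z → ≗⇒≃ {(y +ᴿ z) *ᴿ x} {y *ᴿ x +ᴿ z *ᴿ x}
                     λ n → ℚ.*-distribʳ-+ (seq x n) (seq y n) (seq z n)) }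
    ; *-comm = λ x y → ≗⇒≃ {x *ᴿ y} {y *ᴿ x} λ n → ℚ.*-comm (seq x n) (seq y n) } }

open import Algebra.Properties.Monoid.Sum
  (CommutativeRing.+-monoid ℝ-commutativeRing) public
  using () renaming (sum to ∑)

Matrix : ℕ → Set
Matrix n = Fin n → Fin n → ℝ

infix 4 _≃ᵛ_

_≃ᵛ_ : ∀ {n} → Rel (Vector ℝ n) 0ℓ
v ≃ᵛ w = ∀ i → v i ≃ w i

lincomb : ∀ {n d} → Vector ℝ d → Vector (Vector ℝ n) d → Vector ℝ n
lincomb c b j = ∑ (λ i → c i *ᴿ b i j)

HasDimension : ∀ {n} → Pred (Vector ℝ n) 0ℓ → ℕ → Set
HasDimension {n} W d = ∃[ b ]
  (∀ (i : Fin d) → W (b i)) ×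
  (∀ c → lincomb c b ≃ᵛ (λ _ → 0ᴿ) → c ≃ᵛ (λ _ → 0ᴿ)) ×
  (∀ v → W v → ∃[ c ] v ≃ᵛ lincomb c b)

Eigenspace : ∀ {n} → Matrix n → ℝ → Pred (Vector ℝ n) 0ℓ
Eigenspace M μ v = (λ i → ∑ (λ j → M i j *ᴿ v j)) ≃ᵛ (λ i → μ *ᴿ v i)

HasCardinality : ∀ {n} → Pred (Fin n) 0ℓ → ℕ → Set
HasCardinality {n} P d = ∃[ S ] (∀ (i : Fin n) → i ∈ S ⇔ P i) × ∣ S ∣ ≡ d

-- ev 0 ≥ ev 1 ≥ … lists the eigenvalues of a symmetric matrix M, each real
-- number μ occurring exactly dim ker (M − μ) times (so not at all if it is
-- not an eigenvalue).
IsEigenvalueList : ∀ {n} → Matrix n → Vector ℝ n → Set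
IsEigenvalueList M ev =
  (∀ i j → i Fin.≤ j → ev j ≤ᴿ ev i) ×
  (∀ μ d → HasDimension (Eigenspace M μ) d ⇔ HasCardinality (λ i → ev i ≃ μ) d)

sumFirst : ∀ {n} → ℕ → Vector ℝ n → ℝ
sumFirst k ev = List.foldr _+ᴿ_ 0ᴿ (List.take k (Vector.toList ev))

record SimplicialComplex (N : ℕ) : Set₁ where
  field
    Simplex     : Pred (Subset N) 0ℓ
    simplex?    : Decidable Simplex
    down-closed : ∀ {σ τ} → σ ⊆ τ → Simplex τ → Simplex σ

open SimplicialComplex public

-- Families of simplices are indexed by the number s of vertices, so that
-- s = 0 is allowed: `IsFace X s` is membership in X(s-1), `faces X s`
-- enumerates X(s-1), and `f X s` is f_{s-1}(X).
IsFace : ∀ {N} → SimplicialComplex N → ℕ → Pred (Subset N) 0ℓ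
IsFace X s σ = Simplex X σ × ∣ σ ∣ ≡ s

isFace? : ∀ {N} (X : SimplicialComplex N) s → Decidable (IsFace X s)
isFace? X s σ = simplex? X σ ×-dec (∣ σ ∣ ℕ.≟ s)

allSubsets : ∀ N → List (Subset N)
allSubsets zero    = [] ∷ []
allSubsets (suc N) = List.map (outside ∷_) (allSubsets N) ++ List.map (inside ∷_) (allSubsets N)

faces : ∀ {N} → SimplicialComplex N → ℕ → List (Subset N)
faces {N} X s = filter (isFace? X s) (allSubsets N)

f : ∀ {N} → SimplicialComplex N → ℕ → ℕ
f X s = length (faces X s)

deg : ∀ {N} → SimplicialComplex N → ℕ → Subset N → ℕ
deg X r σ = length (filter (σ ⊆?_) (faces X (suc r)))

open Sort (Flip.decTotalOrder ℕ.≤-decTotalOrder) using () renaming (sort to sort↓)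

-- d_1^{(r)}(X) ≥ d_2^{(r)}(X) ≥ …
degrees : ∀ {N} → SimplicialComplex N → ℕ → List ℕ
degrees X r = sort↓ (List.map (deg X r) (faces X r))

module _ {N : ℕ} {_≺_ : Rel (Fin N) 0ℓ} (≺-sto : IsStrictTotalOrder _≡_ _≺_) where
  open IsStrictTotalOrder ≺-sto using () renaming (_<?_ to _≺?_)

  -- The sign (τ : σ).  When τ ∖ σ = {u}, the filtered list consists of the v ∈ τ
  -- with v ≺ u.
  incidence : Subset N → Subset N → ℤ
  incidence τ σ = -1ℤ ℤ.^ length (filter
    (λ v → (v ∈? τ) ×-dec any? (λ u → (u ∈? (τ ─ σ)) ×-dec (v ≺? u)))
    (allFin N))

  upperLaplacianEntry : SimplicialComplex N → ℕ → Subset N → Subset N → ℤ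
  upperLaplacianEntry X r τ η =
    if does ((suc ∣ τ ∩ η ∣ ℕ.≟ r) ×-dec simplex? X (τ ∪ η))
    then ℤ.- (incidence τ (τ ∩ η) ℤ.* incidence η (τ ∩ η))
    else 0ℤ

  -- L⁺_{r-1}(X), with rows and columns indexed by X(r-1) through `faces X r`.
  upperLaplacian : (X : SimplicialComplex N) (r : ℕ) → Matrix (f X r)
  upperLaplacian X r i j = fromℤ (if does (i Fin.≟ j)
    then + deg X r (lookup (faces X r) i)
    else upperLaplacianEntry X r (lookup (faces X r) i) (lookup (faces X r) j))

{-# OPTIONS --safe #-}

-- A face σ of X(r-1) is determined by its unique coface ρ and the vertex
-- missing from σ, so X(r-1) is in bijection with X(r) × {0, …, r}.  Since the
-- boundary of a boundary vanishes, the entry of the Laplacian L at σ, η is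
-- (ρ:σ)(ρ:η) when σ and η have the same coface ρ, and 0 otherwise: L is block
-- diagonal with blocks w wᵀ, w ∈ {±1}^(r+1).  Its eigenvalues are therefore
-- r + 1, once for each block, and 0.
--
-- Constructively, an eigenvalue is decided to be 0 or r + 1 from a nonzero
-- eigenvector by stability of equality of reals, and the dimension of a
-- subspace is unique because it is the trace of an identity matrix.

module Submission where

open import Defs
open import Data.Fin.Base using (Fin)
open import Data.Fin.Subset using (_⊆_)
open import Data.List.Base using (take; sum)
open import Data.Nat.Base using (ℕ; _+_; _*_; _≤_)
open import Data.Product using (∃; ∃!; _×_)
open import Level using (0ℓ)
open import Relation.Binary.Core using (Rel)
open import Relation.Binary.PropositionalEquality using (_≡_)
open import Relation.Binary.Structures using (IsStrictTotalOrder)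

open import Algebra.Bundles using (CommutativeRing)
import Algebra.Properties.CommutativeSemigroup as CommSemigroupProperties
import Algebra.Properties.Ring as RingProperties
import Algebra.Properties.Semiring.Mult as SemiringMult
import Algebra.Properties.Semiring.Sum as SemiringSum
open import Data.Bool.Base using (true; false; if_then_else_)
open import Data.Empty using (⊥-elim)
open import Data.Fin.Base as Fin using (zero; suc; toℕ)
open import Data.Fin.Permutation using (↔⇒≡)
import Data.Fin.Properties as Fin
open import Data.Fin.Subset using (Subset; inside; outside; _∈_; _∉_; ∁; _∩_; _∪_; _─_; _-_; ∣_∣; ⁅_⁆; ⊥)
open import Data.Fin.Subset.Properties
open import Data.Integer.Base as ℤ using (ℤ; +_; -1ℤ; 0ℤ; 1ℤ)
import Data.Integer.Properties as ℤ
open import Data.List.Base as List using (List; []; _∷_; length; filter; lookup; allFin; map)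
import Data.List.Membership.Propositional as List
import Data.List.Membership.Propositional.Properties as List
import Data.List.Properties as List
import Data.List.Relation.Binary.Permutation.Propositional as ↭
import Data.List.Relation.Binary.Permutation.Propositional.Properties as ↭
open import Data.List.Relation.Unary.All as All using (All; []; _∷_)
import Data.List.Relation.Unary.All.Properties as All
open import Data.List.Relation.Unary.Any as Any using (here; there)
import Data.List.Relation.Unary.Any.Properties as Any
open import Data.List.Relation.Unary.Unique.Propositional using (Unique; []; _∷_)
import Data.List.Relation.Unary.Unique.Propositional.Properties as Unique
import Data.List.Sort as Sort
open import Data.Nat.Base as ℕ using (zero; suc; _<_; z≤n; s≤s)
import Data.Nat.Properties as ℕ
open import Data.Product.Base as Prod using (_,_; proj₁; proj₂; ∃-syntax)
open import Data.Rational.Base as ℚ using (ℚ; 0ℚ; 1ℚ; ½)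
import Data.Rational.Properties as ℚ
import Data.Rational.Unnormalised.Base as ℚᵘ
import Data.Rational.Unnormalised.Properties as ℚᵘ
open import Data.Sum.Base using (_⊎_; inj₁; inj₂; [_,_]′)
open import Data.Vec.Base as Vec using ([]; _∷_)
open import Data.Vec.Functional using (Vector)
import Data.Vec.Properties as Vec
open import Function.Base using (_∘_; case_of_)
open import Function.Bundles using (_↔_; mk↔ₛ′; mk⇔; module Inverse; module Equivalence)
open import Function.Properties.Inverse using (↔-sym; ↔-trans)
open import Level using (_⊔_)
open import Relation.Binary.Definitions using (tri<; tri≈; tri>)
open import Relation.Binary.PropositionalEquality as ≡ using (_≢_)
import Relation.Binary.Reasoning.Setoid as SetoidReasoning
open import Relation.Nullary.Decidable using (Dec; yes; no; does; _×-dec_; ¬?; dec-true; dec-false)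
open import Relation.Nullary.Negation using (¬_)
open import Relation.Unary using (Pred; Decidable)


-- Free modules over a commutative ring

-- Whether a real `μ` equals a given value cannot be decided, yet `IsEigenvalueList` quantifies over
-- every `μ`. The case distinction is therefore made on the natural number `d`. A positive dimension
-- supplies a nonzero eigenvector, a positive cardinality supplies an index with `ev i ≃ μ`, and
-- either places `μ` at 0 or at `r + 1`. For `d` zero those two values have to be refuted instead,
-- which works because both occur with positive multiplicity: `1 ≤ k` guarantees a block, and
-- `1 ≤ r` gives each block a second member. An arbitrary eigenvalue list only has to be tested at
-- these two values: the resulting index sets are disjoint and their sizes add up to the length of
-- the list. The linear algebra is carried out over a commutative ring; the reals enter through
-- cancellation of nonzero factors, characteristic 0, stability of equality with 0, and the gap
-- between 0 and `r + 1`.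

module FreeModule {a ℓ} (R : CommutativeRing a ℓ) where

  open CommutativeRing R hiding (zero) renaming
    (Carrier to A; _+_ to _⊕_; _*_ to _⊗_; -_ to ⊖_; _-_ to _⊝_; isEquivalence to ≈-isEquivalence)
  open RingProperties ring
  open SemiringSum semiring renaming (sum to ∑ᴬ)
  open SemiringMult semiring using () renaming (_×_ to _×ᴬ_)
  open SetoidReasoning setoid

  infix 4 _≈ᵛ_
  _≈ᵛ_ : ∀ {n} → (Fin n → A) → (Fin n → A) → Set ℓ
  v ≈ᵛ w = ∀ i → v i ≈ w i

  combine : ∀ {n d} → (Fin d → A) → (Fin d → Fin n → A) → Fin n → A
  combine c b j = ∑ᴬ (λ i → c i ⊗ b i j)

  HasBasis : ∀ {n p} → ((Fin n → A) → Set p) → ℕ → Set (a ⊔ ℓ ⊔ p)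
  HasBasis {n} W d = ∃[ b ]
    (∀ (i : Fin d) → W (b i)) ×
    (∀ c → combine c b ≈ᵛ (λ _ → 0#) → c ≈ᵛ (λ _ → 0#)) ×
    (∀ v → W v → ∃[ c ] v ≈ᵛ combine c b)

  δ : ∀ {n} → Fin n → Fin n → A
  δ i j = if does (i Fin.≟ j) then 1# else 0#

  δ-≡ : ∀ {n} {i j : Fin n} → i ≡ j → δ i j ≈ 1#
  δ-≡ {i = i} {j} i≡j rewrite dec-true (i Fin.≟ j) i≡j = refl

  δ-≢ : ∀ {n} {i j : Fin n} → i ≢ j → δ i j ≈ 0#
  δ-≢ {i = i} {j} i≢j rewrite dec-false (i Fin.≟ j) i≢j = refl

  ∑0≈0 : ∀ {n} {g : Fin n → A} → (∀ i → g i ≈ 0#) → ∑ᴬ g ≈ 0#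
  ∑0≈0 {n} g≈0 = trans (sum-cong-≋ g≈0) (sum-replicate-zero n)

  ∑-single : ∀ {n} {g : Fin n → A} i → (∀ j → j ≢ i → g j ≈ 0#) → ∑ᴬ g ≈ g i
  ∑-single zero    g≈0 = trans (+-congˡ (∑0≈0 (λ j → g≈0 (suc j) λ ()))) (+-identityʳ _)
  ∑-single (suc i) g≈0 = trans
    (+-cong (g≈0 zero λ ()) (∑-single i λ j j≢i → g≈0 (suc j) (j≢i ∘ Fin.suc-injective)))
    (+-identityˡ _)

  ∑-δ : ∀ {n} i (g : Fin n → A) → ∑[ j < n ] (δ i j ⊗ g j) ≈ g i
  ∑-δ i g = trans
    (∑-single i λ j j≢i → trans (*-congʳ (δ-≢ (j≢i ∘ ≡.sym))) (zeroˡ (g j)))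
    (trans (*-congʳ (δ-≡ {i = i} ≡.refl)) (*-identityˡ (g i)))

  ∑-⊝ : ∀ {n} (g h : Fin n → A) → ∑[ i < n ] (g i ⊝ h i) ≈ ∑ᴬ g ⊝ ∑ᴬ h
  ∑-⊝ {n} g h = begin
    ∑[ i < n ] (g i ⊝ h i)                   ≈⟨ ∑-distrib-+ g (λ i → ⊖ h i) ⟩
    ∑ᴬ g ⊕ ∑[ i < n ] (⊖ h i)               ≈⟨ +-congˡ (sum-cong-≋ {n} λ i → sym (-1*x≈-x (h i))) ⟩
    ∑ᴬ g ⊕ ∑[ i < n ] (⊖ 1# ⊗ h i)          ≈⟨ +-congˡ (sym (*-distribˡ-sum (⊖ 1#) h)) ⟩
    ∑ᴬ g ⊕ ⊖ 1# ⊗ ∑ᴬ h                     ≈⟨ +-congˡ (-1*x≈-x (∑ᴬ h)) ⟩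
    ∑ᴬ g ⊝ ∑ᴬ h                            ∎

  combine-⊝ : ∀ {n d} (c e : Fin d → A) (b : Fin d → Fin n → A) j →
    combine (λ k → c k ⊝ e k) b j ≈ combine c b j ⊝ combine e b j
  combine-⊝ {d = d} c e b j = trans
    (sum-cong-≋ {d} λ k → [y-z]x≈yx-zx (b k j) (c k) (e k))
    (∑-⊝ (λ k → c k ⊗ b k j) (λ k → e k ⊗ b k j))

  ∑∑-assoc : ∀ {m n} (x : Fin m → A) (F : Fin m → Fin n → A) (y : Fin n → A) →
    ∑[ i < m ] (x i ⊗ ∑[ j < n ] (F i j ⊗ y j)) ≈ ∑[ j < n ] (∑[ i < m ] (x i ⊗ F i j) ⊗ y j)
  ∑∑-assoc {m} {n} x F y = begin
    ∑[ i < m ] (x i ⊗ ∑[ j < n ] (F i j ⊗ y j))    ≈⟨ sum-cong-≋ {m} (λ i → *-distribˡ-sum {n} (x i) _) ⟩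
    ∑[ i < m ] ∑[ j < n ] (x i ⊗ (F i j ⊗ y j))    ≈⟨ ∑-comm (λ i j → x i ⊗ (F i j ⊗ y j)) ⟩
    ∑[ j < n ] ∑[ i < m ] (x i ⊗ (F i j ⊗ y j))    ≈⟨ sum-cong-≋ {n} (λ j → sum-cong-≋ {m} λ i → sym (*-assoc (x i) (F i j) (y j))) ⟩
    ∑[ j < n ] ∑[ i < m ] (x i ⊗ F i j ⊗ y j)      ≈⟨ sum-cong-≋ {n} (λ j → sym (*-distribʳ-sum (y j) (λ i → x i ⊗ F i j))) ⟩
    ∑[ j < n ] (∑[ i < m ] (x i ⊗ F i j) ⊗ y j)    ∎

  -- Expanding each basis in the other gives matrices P and Q with PQ = I and
  -- QP = I, and the dimensions are the traces of these products.
  dimension-unique : ∀ {n p d e} {W : (Fin n → A) → Set p} →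
    HasBasis W d → HasBasis W e → d ×ᴬ 1# ≈ e ×ᴬ 1#
  dimension-unique {n} {d = d} {e} {W} (b , b∈W , b-indep , b-span) (b′ , b′∈W , b′-indep , b′-span) = begin
    d ×ᴬ 1#                                    ≈⟨ sym (sum-replicate d) ⟩
    ∑[ i < d ] 1#                             ≈⟨ sum-cong-≋ {d} (λ i → sym (diagonal b b′ b-indep P Q P-eq Q-eq i)) ⟩
    ∑[ i < d ] ∑[ j < e ] (P i j ⊗ Q j i)     ≈⟨ ∑-comm (λ i j → P i j ⊗ Q j i) ⟩
    ∑[ j < e ] ∑[ i < d ] (P i j ⊗ Q j i)     ≈⟨ sum-cong-≋ {e} (λ j → sum-cong-≋ {d} λ i → *-comm (P i j) (Q j i)) ⟩
    ∑[ j < e ] ∑[ i < d ] (Q j i ⊗ P i j)     ≈⟨ sum-cong-≋ {e} (λ j → diagonal b′ b b′-indep Q P Q-eq P-eq j) ⟩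
    ∑[ j < e ] 1#                             ≈⟨ sum-replicate e ⟩
    e ×ᴬ 1#                                    ∎
    where
    P    = λ i → proj₁ (b′-span (b i) (b∈W i))
    P-eq = λ i → proj₂ (b′-span (b i) (b∈W i))
    Q    = λ j → proj₁ (b-span (b′ j) (b′∈W j))
    Q-eq = λ j → proj₂ (b-span (b′ j) (b′∈W j))
    -- Row `i` of `PQ` and the unit vector `δ i` both expand `b i` in the family `b`, so their
    -- difference is a linear relation, which independence forces to vanish.
    diagonal : ∀ {d e} (b : Fin d → Fin n → A) (b′ : Fin e → Fin n → A) →
      (∀ c → combine c b ≈ᵛ (λ _ → 0#) → c ≈ᵛ (λ _ → 0#)) →
      (P : Fin d → Fin e → A) (Q : Fin e → Fin d → A) →
      (∀ i → b i ≈ᵛ combine (P i) b′) → (∀ j → b′ j ≈ᵛ combine (Q j) b) →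
      ∀ i → ∑[ j < e ] (P i j ⊗ Q j i) ≈ 1#
    diagonal {d} {e} b b′ indep P Q P-eq Q-eq i = trans (x-y≈0⇒x≈y (indep c c≈0 i)) (δ-≡ {i = i} ≡.refl)
      where
      PQ = λ k → ∑[ j < e ] (P i j ⊗ Q j k)
      c  = λ k → PQ k ⊝ δ i k
      x-y≈0⇒x≈y : ∀ {x y} → x ⊝ y ≈ 0# → x ≈ y
      x-y≈0⇒x≈y {x} {y} = x∙y⁻¹≈ε⇒x≈y x y
      c≈0 : combine c b ≈ᵛ (λ _ → 0#)
      c≈0 l = begin
        combine c b l                                 ≈⟨ combine-⊝ PQ (δ i) b l ⟩
        combine PQ b l ⊝ combine (δ i) b l            ≈⟨ +-cong (sym (∑∑-assoc (P i) Q (λ k → b k l))) (-‿cong (∑-δ i (λ k → b k l))) ⟩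
        ∑[ j < e ] (P i j ⊗ combine (Q j) b l) ⊝ b i l ≈⟨ +-congʳ (sum-cong-≋ {e} λ j → *-congˡ (sym (Q-eq j l))) ⟩
        combine (P i) b′ l ⊝ b i l                    ≈⟨ +-congʳ (sym (P-eq i l)) ⟩
        b i l ⊝ b i l                                 ≈⟨ -‿inverseʳ (b i l) ⟩
        0#                                            ∎

  -- Eigenvectors and the pairing of vectors

  IsEigenvector : ∀ {n} → (Fin n → Fin n → A) → A → (Fin n → A) → Set ℓ
  IsEigenvector M μ v = (λ i → ∑ᴬ (λ j → M i j ⊗ v j)) ≈ᵛ (λ i → μ ⊗ v i)

  infix 8 _·_
  _·_ : ∀ {n} → (Fin n → A) → (Fin n → A) → A
  x · v = ∑ᴬ (λ j → x j ⊗ v j)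

  ·-cong : ∀ {n} (x : Fin n → A) {v v′} → v ≈ᵛ v′ → x · v ≈ x · v′
  ·-cong {n} x v≈v′ = sum-cong-≋ {n} λ j → *-congˡ (v≈v′ j)

  ·-⊝ : ∀ {n} (x v v′ : Fin n → A) → x · (λ j → v j ⊝ v′ j) ≈ x · v ⊝ x · v′
  ·-⊝ {n} x v v′ = trans
    (sum-cong-≋ {n} λ j → x[y-z]≈xy-xz (x j) (v j) (v′ j))
    (∑-⊝ (λ j → x j ⊗ v j) (λ j → x j ⊗ v′ j))

  ·-scale : ∀ {n} (x : Fin n → A) μ v → x · (λ j → μ ⊗ v j) ≈ μ ⊗ x · v
  ·-scale {n} x μ v = begin
    ∑[ j < n ] (x j ⊗ (μ ⊗ v j))   ≈⟨ sum-cong-≋ {n} (λ j → x∙yz≈y∙xz (x j) μ (v j)) ⟩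
    ∑[ j < n ] (μ ⊗ (x j ⊗ v j))   ≈⟨ sym (*-distribˡ-sum μ (λ j → x j ⊗ v j)) ⟩
    μ ⊗ x · v                      ∎
    where open CommSemigroupProperties *-commutativeSemigroup

  ·-combine : ∀ {n d} (x : Fin n → A) c (b : Fin d → Fin n → A) →
    x · combine c b ≈ ∑[ k < d ] (c k ⊗ x · b k)
  ·-combine {n} {d} x c b = begin
    x · combine c b
      ≈⟨ sum-cong-≋ {n} (λ j → *-congˡ {x j} (sum-cong-≋ {d} λ k → *-comm (c k) (b k j))) ⟩
    ∑[ j < n ] (x j ⊗ ∑[ k < d ] (b k j ⊗ c k))
      ≈⟨ ∑∑-assoc x (λ j k → b k j) c ⟩
    ∑[ k < d ] (x · b k ⊗ c k)
      ≈⟨ sum-cong-≋ {d} (λ k → *-comm (x · b k) (c k)) ⟩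
    ∑[ k < d ] (c k ⊗ x · b k) ∎

  -- Spectrum of a block matrix with rank-one blocks of signs

  module SignedPartition {n m r : ℕ}
    (partition : Fin n ↔ (Fin m × Fin (suc r)))
    (w : Fin n → A) (w² : ∀ i → w i ⊗ w i ≈ 1#)
    (M : Fin n → Fin n → A)
    (M-entry : ∀ i j → M i j ≈
      δ (proj₁ (Inverse.to partition i)) (proj₁ (Inverse.to partition j)) ⊗ (w i ⊗ w j))
    where

    open CommSemigroupProperties *-commutativeSemigroup

    block : Fin n → Fin m
    block i = proj₁ (Inverse.to partition i)

    place : Fin n → Fin (suc r)
    place i = proj₂ (Inverse.to partition i)

    member : Fin m → Fin (suc r) → Fin n
    member t s = Inverse.from partition (t , s)

    block-member : ∀ t s → block (member t s) ≡ t
    block-member t s = ≡.cong proj₁ (Inverse.strictlyInverseˡ partition (t , s))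

    place-member : ∀ t s → place (member t s) ≡ s
    place-member t s = ≡.cong proj₂ (Inverse.strictlyInverseˡ partition (t , s))

    member-block-place : ∀ i → member (block i) (place i) ≡ i
    member-block-place = Inverse.strictlyInverseʳ partition

    -- The common block size as a ring element. It is also the pairing of a block's sign vector with
    -- itself, hence the nonzero eigenvalue.
    q : A
    q = suc r ×ᴬ 1#

    -- Each weight is its own inverse, so multiplying by it once more undoes it.
    w-cancel : ∀ i {x} → w i ⊗ x ≈ 0# → x ≈ 0#
    w-cancel i {x} wx≈0 = begin
      x                 ≈⟨ sym (*-identityˡ x) ⟩
      1# ⊗ x            ≈⟨ *-congʳ (sym (w² i)) ⟩
      w i ⊗ w i ⊗ x     ≈⟨ *-assoc (w i) (w i) x ⟩
      w i ⊗ (w i ⊗ x)   ≈⟨ *-congˡ wx≈0 ⟩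
      w i ⊗ 0#          ≈⟨ zeroʳ (w i) ⟩
      0#                ∎

    -- The restriction of `w` to block `t`; `M` is the sum over `t` of the outer products of
    -- `signs t` with itself.
    signs : Fin m → Fin n → A
    signs t j = w j ⊗ δ t (block j)

    -- Double counting: the indicator of a block is the sum of the indicators of its `suc r`
    -- members.
    ∑-block : ∀ t → ∑[ j < n ] δ t (block j) ≈ q
    ∑-block t = begin
      ∑[ j < n ] δ t (block j)
        ≈⟨ sum-cong-≋ {n} (λ j → sym (∑-members j)) ⟩
      ∑[ j < n ] ∑[ s < suc r ] δ (member t s) j
        ≈⟨ ∑-comm (λ j s → δ (member t s) j) ⟩
      ∑[ s < suc r ] ∑[ j < n ] δ (member t s) j
        ≈⟨ sum-cong-≋ {suc r} (λ s → trans
             (∑-single {n} (member t s) λ j j≢ → δ-≢ (j≢ ∘ ≡.sym))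
             (δ-≡ {i = member t s} ≡.refl)) ⟩
      ∑[ s < suc r ] 1#
        ≈⟨ sum-replicate (suc r) ⟩
      q ∎
      where
      ∑-members : ∀ j → ∑[ s < suc r ] δ (member t s) j ≈ δ t (block j)
      ∑-members j with t Fin.≟ block j
      ... | yes ≡.refl = trans
        (∑-single {suc r} (place j) λ s s≢ → δ-≢ λ eq →
          s≢ (≡.trans (≡.sym (place-member (block j) s)) (≡.cong place eq)))
        (δ-≡ (member-block-place j))
      ... | no t≢ = ∑0≈0 {suc r} λ s → δ-≢ λ eq →
        t≢ (≡.trans (≡.sym (block-member t s)) (≡.cong block eq))

    -- On block `t` the two weights cancel and `g ∘ block` is constant, so each member contributes
    -- one copy of `g t`. Taking `g` to be `δ t` gives the eigenvectors, and taking `g` to be the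
    -- block pairings of `v` gives the quadratic relation below.
    signs-· : ∀ t (g : Fin m → A) → signs t · (λ j → w j ⊗ g (block j)) ≈ q ⊗ g t
    signs-· t g = begin
      ∑[ j < n ] (w j ⊗ δ t (block j) ⊗ (w j ⊗ g (block j)))
        ≈⟨ sum-cong-≋ {n} (λ j → begin
             w j ⊗ δ t (block j) ⊗ (w j ⊗ g (block j))     ≈⟨ interchange (w j) _ (w j) _ ⟩
             w j ⊗ w j ⊗ (δ t (block j) ⊗ g (block j))     ≈⟨ *-cong (w² j) (localise j) ⟩
             1# ⊗ (δ t (block j) ⊗ g t)                    ≈⟨ *-identityˡ _ ⟩
             δ t (block j) ⊗ g t                           ∎) ⟩
      ∑[ j < n ] (δ t (block j) ⊗ g t)
        ≈⟨ sym (*-distribʳ-sum {n} (g t) (λ j → δ t (block j))) ⟩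
      ∑[ j < n ] δ t (block j) ⊗ g t
        ≈⟨ *-congʳ (∑-block t) ⟩
      q ⊗ g t ∎
      where
      localise : ∀ j → δ t (block j) ⊗ g (block j) ≈ δ t (block j) ⊗ g t
      localise j with t Fin.≟ block j
      ... | yes ≡.refl = refl
      ... | no  _      = trans (zeroˡ _) (sym (zeroˡ _))

    M-action : ∀ v i → ∑[ j < n ] (M i j ⊗ v j) ≈ w i ⊗ signs (block i) · v
    M-action v i = begin
      ∑[ j < n ] (M i j ⊗ v j)
        ≈⟨ sum-cong-≋ {n} (λ j → begin
             M i j ⊗ v j                                       ≈⟨ *-congʳ (M-entry i j) ⟩
             δ (block i) (block j) ⊗ (w i ⊗ w j) ⊗ v j         ≈⟨ *-congʳ (x∙yz≈y∙zx (δ (block i) (block j)) (w i) (w j)) ⟩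
             w i ⊗ (w j ⊗ δ (block i) (block j)) ⊗ v j         ≈⟨ *-assoc (w i) _ (v j) ⟩
             w i ⊗ (signs (block i) j ⊗ v j)                   ∎) ⟩
      ∑[ j < n ] (w i ⊗ (signs (block i) j ⊗ v j))
        ≈⟨ sym (*-distribˡ-sum {n} (w i) (λ j → signs (block i) j ⊗ v j)) ⟩
      w i ⊗ signs (block i) · v ∎

    eigen-· : ∀ {μ v} → IsEigenvector M μ v → ∀ i → w i ⊗ signs (block i) · v ≈ μ ⊗ v i
    eigen-· {v = v} eig i = trans (sym (M-action v i)) (eig i)

    -- This is `M² = q M` applied to an eigenvector, kept in a form without division. Pairing the
    -- eigenvector equation with `signs t` gives `q L = μ L` for the pairing `L` of `signs t` with
    -- `v`, and `w i ⊗ L` is `μ ⊗ v i`.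
    eigen-quadratic : ∀ {μ v} → IsEigenvector M μ v → ∀ i → (q ⊝ μ) ⊗ (μ ⊗ v i) ≈ 0#
    eigen-quadratic {μ} {v} eig i = begin
      (q ⊝ μ) ⊗ (μ ⊗ v i)      ≈⟨ *-congˡ (sym (eigen-· eig i)) ⟩
      (q ⊝ μ) ⊗ (w i ⊗ L t)    ≈⟨ x∙yz≈y∙xz (q ⊝ μ) (w i) (L t) ⟩
      w i ⊗ ((q ⊝ μ) ⊗ L t)    ≈⟨ *-congˡ ([y-z]x≈yx-zx (L t) q μ) ⟩
      w i ⊗ (q ⊗ L t ⊝ μ ⊗ L t) ≈⟨ *-congˡ (+-cong (sym (signs-· t L)) (-‿cong (sym (·-scale (signs t) μ v)))) ⟩
      w i ⊗ (signs t · (λ j → w j ⊗ L (block j)) ⊝ signs t · (λ j → μ ⊗ v j))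
        ≈⟨ *-congˡ (+-congʳ (·-cong (signs t) (eigen-· eig))) ⟩
      w i ⊗ (signs t · (λ j → μ ⊗ v j) ⊝ signs t · (λ j → μ ⊗ v j))
        ≈⟨ *-congˡ (-‿inverseʳ _) ⟩
      w i ⊗ 0#                 ≈⟨ zeroʳ (w i) ⟩
      0#                       ∎
      where
      t = block i
      L = λ t → signs t · v

    signs-eigenvector : ∀ t → IsEigenvector M q (signs t)
    signs-eigenvector t i = begin
      ∑[ j < n ] (M i j ⊗ signs t j)     ≈⟨ M-action (signs t) i ⟩
      w i ⊗ signs (block i) · signs t    ≈⟨ *-congˡ (signs-· (block i) (δ t)) ⟩
      w i ⊗ (q ⊗ δ t (block i))          ≈⟨ x∙yz≈y∙xz (w i) q _ ⟩
      q ⊗ signs t i                      ∎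

    combine-signs : ∀ c i → combine c signs i ≈ w i ⊗ c (block i)
    combine-signs c i = begin
      ∑[ t < m ] (c t ⊗ (w i ⊗ δ t (block i)))
        ≈⟨ ∑-single {m} (block i) (λ t t≢ → trans (*-congˡ (trans (*-congˡ (δ-≢ t≢)) (zeroʳ _))) (zeroʳ _)) ⟩
      c (block i) ⊗ (w i ⊗ δ (block i) (block i))
        ≈⟨ *-congˡ (trans (*-congˡ (δ-≡ {i = block i} ≡.refl)) (*-identityʳ (w i))) ⟩
      c (block i) ⊗ w i
        ≈⟨ *-comm _ _ ⟩
      w i ⊗ c (block i) ∎

    -- Integrality is phrased as cancellation of a nonzero factor; for the reals, which factor of a
    -- zero product vanishes cannot be decided.
    module _ (no-zero-divisors : ∀ x y → x ⊗ y ≈ 0# → ¬ x ≈ 0# → y ≈ 0#)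
             (char-0 : ∀ n → ¬ suc n ×ᴬ 1# ≈ 0#) where

      private
        cancel : ∀ {x y} → x ⊗ y ≈ 0# → ¬ x ≈ 0# → y ≈ 0#
        cancel = no-zero-divisors _ _

      ×1-injective : ∀ {j k} → j ×ᴬ 1# ≈ k ×ᴬ 1# → j ≡ k
      ×1-injective {zero}  {zero}  eq = ≡.refl
      ×1-injective {zero}  {suc k} eq = ⊥-elim (char-0 k (sym eq))
      ×1-injective {suc j} {zero}  eq = ⊥-elim (char-0 j eq)
      ×1-injective {suc j} {suc k} eq = ≡.cong suc (×1-injective (+-cancelˡ 1# _ _ eq))

      -- For an eigenvector `v` of `q`, the value `q ⊗ (w i ⊗ v i)` is the pairing of `v` with its
      -- block, so it depends on the block alone. Cancelling `q` makes `w i ⊗ v i` constant on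
      -- blocks, and that constant, read off at place zero, is the coefficient.
      q-eigenspace : HasBasis (IsEigenvector M q) m
      q-eigenspace = signs , signs-eigenvector , independent , spanning
        where
        independent : ∀ c → combine c signs ≈ᵛ (λ _ → 0#) → c ≈ᵛ (λ _ → 0#)
        independent c c≈0 t = ≡.subst (λ t → c t ≈ 0#) (block-member t zero)
          (w-cancel i (trans (sym (combine-signs c i)) (c≈0 i)))
          where i = member t zero
        spanning : ∀ v → IsEigenvector M q v → ∃[ c ] v ≈ᵛ combine c signs
        spanning v eig = c , λ i → begin
          v i                  ≈⟨ sym (*-identityˡ (v i)) ⟩
          1# ⊗ v i             ≈⟨ *-congʳ (sym (w² i)) ⟩
          w i ⊗ w i ⊗ v i      ≈⟨ *-assoc (w i) (w i) (v i) ⟩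
          w i ⊗ (w i ⊗ v i)    ≈⟨ *-congˡ (constant i) ⟩
          w i ⊗ c (block i)    ≈⟨ sym (combine-signs c i) ⟩
          combine c signs i    ∎
          where
          rep = λ t → member t zero
          c   = λ t → w (rep t) ⊗ v (rep t)
          total : ∀ i → q ⊗ (w i ⊗ v i) ≈ signs (block i) · v
          total i = begin
            q ⊗ (w i ⊗ v i)                      ≈⟨ x∙yz≈y∙xz q (w i) (v i) ⟩
            w i ⊗ (q ⊗ v i)                      ≈⟨ *-congˡ (sym (eigen-· eig i)) ⟩
            w i ⊗ (w i ⊗ signs (block i) · v)    ≈⟨ sym (*-assoc (w i) (w i) _) ⟩
            w i ⊗ w i ⊗ signs (block i) · v      ≈⟨ *-congʳ (w² i) ⟩
            1# ⊗ signs (block i) · v             ≈⟨ *-identityˡ _ ⟩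
            signs (block i) · v                  ∎
          constant : ∀ i → w i ⊗ v i ≈ c (block i)
          constant i = x∙y⁻¹≈ε⇒x≈y _ _ (cancel (begin
            q ⊗ (w i ⊗ v i ⊝ c (block i))
              ≈⟨ x[y-z]≈xy-xz q _ _ ⟩
            q ⊗ (w i ⊗ v i) ⊝ q ⊗ c (block i)
              ≈⟨ +-cong (total i) (-‿cong (total (rep (block i)))) ⟩
            signs (block i) · v ⊝ signs (block (rep (block i))) · v
              ≡⟨ ≡.cong (λ t → signs (block i) · v ⊝ signs t · v) (block-member (block i) zero) ⟩
            signs (block i) · v ⊝ signs (block i) · v
              ≈⟨ -‿inverseʳ _ ⟩
            0# ∎) (char-0 r))

      -- In each block the member at place zero is the representative.
      block-of : Fin (m * r) → Fin m
      block-of k = proj₁ (Fin.remQuot {m} r k)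

      non-rep rep : Fin (m * r) → Fin n
      non-rep k = member (block-of k) (suc (proj₂ (Fin.remQuot {m} r k)))
      rep     k = member (block-of k) zero

      -- The weights make each vector orthogonal to every `signs t`: its two nonzero entries lie in
      -- the same block and pair to `w² = 1` with opposite signs.
      differences : Fin (m * r) → Fin n → A
      differences k i = δ (non-rep k) i ⊗ w i ⊝ δ (rep k) i ⊗ w i

      0-eigenspace : HasBasis (IsEigenvector M 0#) (m * r)
      0-eigenspace = differences , eigenvector , independent , spanning
        where
        signs-·-differences : ∀ t k → signs t · differences k ≈ 0#
        signs-·-differences t₀ k = begin
          signs t₀ · differences k
            ≈⟨ ·-⊝ (signs t₀) (λ j → δ (non-rep k) j ⊗ w j) (λ j → δ (rep k) j ⊗ w j) ⟩
          signs t₀ · (λ j → δ (non-rep k) j ⊗ w j) ⊝ signs t₀ · (λ j → δ (rep k) j ⊗ w j)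
            ≈⟨ +-cong (pick (non-rep k)) (-‿cong (pick (rep k))) ⟩
          δ t₀ (block (non-rep k)) ⊝ δ t₀ (block (rep k))
            ≡⟨ ≡.cong₂ (λ a b → δ t₀ a ⊝ δ t₀ b) (block-member _ _) (block-member _ _) ⟩
          δ t₀ (block-of k) ⊝ δ t₀ (block-of k)
            ≈⟨ -‿inverseʳ _ ⟩
          0# ∎
          where
          pick : ∀ i → signs t₀ · (λ j → δ i j ⊗ w j) ≈ δ t₀ (block i)
          pick i = begin
            ∑[ j < n ] (w j ⊗ δ t₀ (block j) ⊗ (δ i j ⊗ w j))
              ≈⟨ sum-cong-≋ {n} (λ j → begin
                   w j ⊗ δ t₀ (block j) ⊗ (δ i j ⊗ w j)   ≈⟨ x∙yz≈y∙xz _ (δ i j) (w j) ⟩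
                   δ i j ⊗ (w j ⊗ δ t₀ (block j) ⊗ w j)   ≈⟨ *-congˡ (xy∙z≈x∙zy (w j) _ (w j)) ⟩
                   δ i j ⊗ (w j ⊗ (w j ⊗ δ t₀ (block j)))  ≈⟨ *-congˡ (sym (*-assoc (w j) (w j) _)) ⟩
                   δ i j ⊗ (w j ⊗ w j ⊗ δ t₀ (block j))   ≈⟨ *-congˡ (*-congʳ (w² j)) ⟩
                   δ i j ⊗ (1# ⊗ δ t₀ (block j))          ≈⟨ *-congˡ (*-identityˡ _) ⟩
                   δ i j ⊗ δ t₀ (block j)                 ∎) ⟩
            ∑[ j < n ] (δ i j ⊗ δ t₀ (block j))
              ≈⟨ ∑-δ i (λ j → δ t₀ (block j)) ⟩
            δ t₀ (block i) ∎

        eigenvector : ∀ k → IsEigenvector M 0# (differences k)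
        eigenvector k i = begin
          ∑[ j < n ] (M i j ⊗ differences k j)    ≈⟨ M-action (differences k) i ⟩
          w i ⊗ signs (block i) · differences k   ≈⟨ *-congˡ (signs-·-differences (block i) k) ⟩
          w i ⊗ 0#                                ≈⟨ zeroʳ (w i) ⟩
          0#                                      ≈⟨ sym (zeroˡ _) ⟩
          0# ⊗ differences k i                    ∎

        non-rep-injective : ∀ {k l} → non-rep k ≡ non-rep l → k ≡ l
        non-rep-injective {k} {l} eq = ≡.trans (≡.sym (Fin.combine-remQuot {m} r k)) (≡.trans
          (≡.cong₂ Fin.combine
            (≡.trans (≡.sym (block-member _ _)) (≡.trans (≡.cong block eq) (block-member _ _)))
            (Fin.suc-injective
              (≡.trans (≡.sym (place-member _ _)) (≡.trans (≡.cong place eq) (place-member _ _)))))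
          (Fin.combine-remQuot {m} r l))

        non-rep≢rep : ∀ k l → rep k ≢ non-rep l
        non-rep≢rep k l eq = case
          ≡.trans (≡.sym (place-member _ _)) (≡.trans (≡.cong place eq) (place-member _ _)) of λ ()

        -- A non-representative lies in the support of exactly one difference vector, so evaluating
        -- there isolates one coefficient.
        at-non-rep : ∀ c l → combine c differences (non-rep l) ≈ w (non-rep l) ⊗ c l
        at-non-rep c l = begin
          ∑[ k < m * r ] (c k ⊗ differences k i)
            ≈⟨ ∑-single l (λ k k≢l → begin
                 c k ⊗ (δ (non-rep k) i ⊗ w i ⊝ δ (rep k) i ⊗ w i)
                   ≈⟨ *-congˡ (+-cong (*-congʳ (δ-≢ (k≢l ∘ non-rep-injective))) (-‿cong (*-congʳ (δ-≢ (non-rep≢rep k l))))) ⟩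
                 c k ⊗ (0# ⊗ w i ⊝ 0# ⊗ w i)
                   ≈⟨ *-congˡ (-‿inverseʳ _) ⟩
                 c k ⊗ 0#
                   ≈⟨ zeroʳ (c k) ⟩
                 0# ∎) ⟩
          c l ⊗ (δ i i ⊗ w i ⊝ δ (rep l) i ⊗ w i)
            ≈⟨ *-congˡ (+-cong
                 (trans (*-congʳ (δ-≡ {i = i} ≡.refl)) (*-identityˡ (w i)))
                 (trans (-‿cong (trans (*-congʳ (δ-≢ (non-rep≢rep l l))) (zeroˡ (w i)))) -0#≈0#)) ⟩
          c l ⊗ (w i ⊕ 0#)
            ≈⟨ *-congˡ (+-identityʳ (w i)) ⟩
          c l ⊗ w i
            ≈⟨ *-comm (c l) (w i) ⟩
          w i ⊗ c l ∎
          where i = non-rep l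

        independent : ∀ c → combine c differences ≈ᵛ (λ _ → 0#) → c ≈ᵛ (λ _ → 0#)
        independent c c≈0 l = w-cancel (non-rep l) (trans (sym (at-non-rep c l)) (c≈0 (non-rep l)))

        -- The remainder u vanishes off the representatives and is orthogonal to
        -- the sign vector of each block, hence vanishes there too.
        spanning : ∀ v → IsEigenvector M 0# v → ∃[ c ] v ≈ᵛ combine c differences
        spanning v eig = c , λ i → x∙y⁻¹≈ε⇒x≈y _ _
          (≡.subst (λ i → u i ≈ 0#) (member-block-place i) (u≈0 (block i) (place i)))
          where
          c : Fin (m * r) → A
          -- Forced by `at-non-rep`: since `w² = 1`, this choice makes the remainder vanish at every
          -- non-representative.
          c k = w (non-rep k) ⊗ v (non-rep k)

          u : Fin n → A
          u i = v i ⊝ combine c differences i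

          u≈0-off-rep : ∀ t s → u (member t (suc s)) ≈ 0#
          u≈0-off-rep t s = ≡.subst (λ (t , s) → u (member t (suc s)) ≈ 0#) (Fin.remQuot-combine t s) (begin
            v i ⊝ combine c differences i   ≈⟨ +-congˡ (-‿cong (at-non-rep c k)) ⟩
            v i ⊝ w i ⊗ (w i ⊗ v i)         ≈⟨ +-congˡ (-‿cong (sym (*-assoc (w i) (w i) (v i)))) ⟩
            v i ⊝ w i ⊗ w i ⊗ v i           ≈⟨ +-congˡ (-‿cong (*-congʳ (w² i))) ⟩
            v i ⊝ 1# ⊗ v i                  ≈⟨ +-congˡ (-‿cong (*-identityˡ (v i))) ⟩
            v i ⊝ v i                       ≈⟨ -‿inverseʳ (v i) ⟩
            0#                              ∎)
            where
            k = Fin.combine t s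
            i = non-rep k

          signs-·-v : ∀ t → signs t · v ≈ 0#
          signs-·-v t = ≡.subst (λ t → signs t · v ≈ 0#) (block-member t zero)
            (w-cancel i (trans (eigen-· eig i) (zeroˡ (v i))))
            where i = member t zero

          signs-·-u : ∀ t → signs t · u ≈ 0#
          signs-·-u t = begin
            signs t · u
              ≈⟨ ·-⊝ (signs t) v (combine c differences) ⟩
            signs t · v ⊝ signs t · combine c differences
              ≈⟨ +-cong (signs-·-v t) (-‿cong (trans (·-combine (signs t) c differences)
                   (∑0≈0 λ k → trans (*-congˡ (signs-·-differences t k)) (zeroʳ (c k))))) ⟩
            0# ⊝ 0#
              ≈⟨ -‿inverseʳ 0# ⟩
            0# ∎

          u≈0-at-rep : ∀ t → u (member t zero) ≈ 0#
          u≈0-at-rep t = w-cancel i (begin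
            w i ⊗ u i                        ≈⟨ *-congʳ (sym (*-identityʳ (w i))) ⟩
            w i ⊗ 1# ⊗ u i                   ≈⟨ *-congʳ (*-congˡ (sym (δ-≡ (≡.sym (block-member t zero))))) ⟩
            signs t i ⊗ u i                  ≈⟨ sym (∑-single i others) ⟩
            signs t · u                      ≈⟨ signs-·-u t ⟩
            0#                               ∎)
            where
            i = member t zero
            others : ∀ j → j ≢ i → signs t j ⊗ u j ≈ 0#
            others j j≢i with t Fin.≟ block j | place j in place-j
            ... | no _ | _ = trans (*-congʳ (zeroʳ (w j))) (zeroˡ (u j))
            ... | yes ≡.refl | zero = ⊥-elim (j≢i
              (≡.trans (≡.sym (member-block-place j)) (≡.cong (member (block j)) place-j)))
            ... | yes ≡.refl | suc s = trans (*-congˡ (≡.subst (λ i → u i ≈ 0#)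
              (≡.trans (≡.cong (member (block j)) (≡.sym place-j)) (member-block-place j))
              (u≈0-off-rep (block j) s))) (zeroʳ _)

          u≈0 : ∀ t s → u (member t s) ≈ 0#
          u≈0 t zero    = u≈0-at-rep t
          u≈0 t (suc s) = u≈0-off-rep t s

      -- A substitute for deciding `μ ≈ 0#` or `μ ≈ q`: at least one of the two can always be
      -- excluded.
      module _ (≈0-stable : ∀ x → ¬ ¬ x ≈ 0# → x ≈ 0#)
               (separate : ∀ μ → ¬ μ ≈ 0# ⊎ ¬ q ⊝ μ ≈ 0#) where

        -- `separate` excludes one candidate. If the other failed too, both factors could be
        -- cancelled from `eigen-quadratic`, making `v` zero; stability turns this refutation into
        -- an equality.
        only-eigenvalues : ∀ {μ v} → IsEigenvector M μ v → ¬ v ≈ᵛ (λ _ → 0#) → μ ≈ q ⊎ μ ≈ 0#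
        only-eigenvalues {μ} {v} eig v≉0 with separate μ
        ... | inj₁ μ≉0 = inj₁ (sym (x∙y⁻¹≈ε⇒x≈y q μ (≈0-stable _ λ q-μ≉0 →
          v≉0 λ i → cancel (cancel (eigen-quadratic eig i) q-μ≉0) μ≉0)))
        ... | inj₂ q-μ≉0 = inj₂ (≈0-stable _ λ μ≉0 →
          v≉0 λ i → cancel (cancel (eigen-quadratic eig i) q-μ≉0) μ≉0)

        -- A basis vector is nonzero: otherwise the unit coefficients `δ zero` would form a linear
        -- relation, and independence would give `1# ≈ 0#`.
        basis⇒eigenvalue : ∀ {μ d} → HasBasis (IsEigenvector M μ) (suc d) → μ ≈ q ⊎ μ ≈ 0#
        basis⇒eigenvalue {d = d} (b , eig , indep , _) = only-eigenvalues (eig zero) λ b₀≈0 →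
          char-0 0 (trans (+-identityʳ 1#) (trans (sym (δ-≡ {i = zero {d}} ≡.refl))
            (indep (δ zero) (λ j → trans (∑-δ zero (λ k → b k j)) (b₀≈0 j)) zero)))

        no-eigenvalue : ∀ {μ} → ¬ μ ≈ q → ¬ μ ≈ 0# → HasBasis (IsEigenvector M μ) 0
        no-eigenvalue {μ} μ≉q μ≉0 = (λ ()) , (λ ()) , (λ _ _ ()) , λ v eig → (λ ()) , λ i →
          cancel (cancel (eigen-quadratic eig i) λ q-μ≈0 → μ≉q (sym (x∙y⁻¹≈ε⇒x≈y q μ q-μ≈0))) μ≉0

  HasBasis-resp : ∀ {n d} {M : Fin n → Fin n → A} {μ ν} → μ ≈ ν →
    HasBasis (IsEigenvector M μ) d → HasBasis (IsEigenvector M ν) d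
  HasBasis-resp μ≈ν (b , eig , indep , span) =
    b , (λ i j → trans (eig i j) (*-congʳ μ≈ν)) , indep ,
    λ v eig′ → span v λ j → trans (eig′ j) (*-congʳ (sym μ≈ν))

-- Real numbers

open SemiringMult (CommutativeRing.semiring ℝ-commutativeRing) using (×-assocˡ) renaming (_×_ to _×ᴿ_)

-- The positive form of being nonzero, with an explicit rational lower bound on the eventual
-- absolute value.
Apart₀ : ℝ → Set
Apart₀ x = ∃[ δ ] 0ℚ ℚ.< δ × ∃[ N ] ∀ n → N ℕ.≤ n → δ ℚ.≤ ℚ.∣ seq x n ∣

<⇒≱ : ∀ {p q} → p ℚ.< q → ¬ q ℚ.≤ p
<⇒≱ p<q q≤p = ℚ.<-irrefl ≡.refl (ℚ.<-≤-trans p<q q≤p)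

-0-absorb : ∀ p → p ℚ.- 0ℚ ≡ p
-0-absorb p = ℚ.+-identityʳ p

≤-∣-∣ : ∀ p → p ℚ.≤ ℚ.∣ p ∣
≤-∣-∣ p with ℚ.≤-total 0ℚ p
... | inj₁ 0≤p = ℚ.≤-reflexive (≡.sym (ℚ.0≤p⇒∣p∣≡p 0≤p))
... | inj₂ p≤0 = ℚ.≤-trans p≤0 (ℚ.0≤∣p∣ p)

-+-cancel : ∀ p q → (p ℚ.- q) ℚ.+ q ≡ p
-+-cancel p q = ≡.trans (ℚ.+-assoc p (ℚ.- q) q)
  (≡.trans (≡.cong (p ℚ.+_) (ℚ.+-inverseˡ q)) (ℚ.+-identityʳ p))

∣∣-split : ∀ {p q ε} → ℚ.∣ p ℚ.- q ∣ ℚ.< ½ ℚ.* ε → ℚ.∣ q ∣ ℚ.< ½ ℚ.* ε → ℚ.∣ p ∣ ℚ.< ε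
∣∣-split {p} {q} {ε} close small = ≡.subst (λ p → ℚ.∣ p ∣ ℚ.< ε) (-+-cancel p q) (∣+∣< close small)

-- One rational sample decides. The index `N` lies beyond the Cauchy moduli for `ε/2` and for half
-- of `ε/2`: a sample below `ε/2` keeps later terms below `ε`, and any other sample keeps them at or
-- above half of `ε/2`.
small-or-apart : ∀ x ε → 0ℚ ℚ.< ε →
  (∃[ N ] ∀ n → N ℕ.≤ n → ℚ.∣ seq x n ∣ ℚ.< ε) ⊎ Apart₀ x
small-or-apart x ε 0<ε = decide (ℚ.∣ seq x N ∣ ℚ.<? ε/2)
  where
  ε/2 = ½ ℚ.* ε
  0<ε/2 = halve ε 0<ε
  N₁ = proj₁ (cauchy x ε/2 0<ε/2)
  N₂ = proj₁ (cauchy x (½ ℚ.* ε/2) (halve ε/2 0<ε/2))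
  N = N₁ ℕ.⊔ N₂
  N₁≤ : ∀ {n} → N ℕ.≤ n → N₁ ℕ.≤ n
  N₁≤ = ℕ.m⊔n≤o⇒m≤o N₁ N₂
  N₂≤ : ∀ {n} → N ℕ.≤ n → N₂ ℕ.≤ n
  N₂≤ = ℕ.m⊔n≤o⇒n≤o N₁ N₂
  decide : Dec (ℚ.∣ seq x N ∣ ℚ.< ε/2) → (∃[ N ] ∀ n → N ℕ.≤ n → ℚ.∣ seq x n ∣ ℚ.< ε) ⊎ Apart₀ x
  decide (yes small) = inj₁ (N , λ n N≤n →
    ∣∣-split (proj₂ (cauchy x ε/2 0<ε/2) n N (N₁≤ N≤n) (N₁≤ ℕ.≤-refl)) small)
  decide (no ¬small) = inj₂ (½ ℚ.* ε/2 , halve ε/2 0<ε/2 , N , λ n N≤n → ℚ.≮⇒≥ λ small → ¬small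
    (∣∣-split (proj₂ (cauchy x (½ ℚ.* ε/2) (halve ε/2 0<ε/2)) N n (N₂≤ ℕ.≤-refl) (N₂≤ N≤n)) small))

apart⇒≄0 : ∀ {x} → Apart₀ x → ¬ x ≃ 0ᴿ
apart⇒≄0 {x} (δ , 0<δ , N , away) x≃0 with x≃0 δ 0<δ
... | M , close = <⇒≱ (≡.subst (λ p → ℚ.∣ p ∣ ℚ.< δ) (-0-absorb _) (close (N ℕ.⊔ M) (ℕ.m≤n⊔m N M)))
  (away (N ℕ.⊔ M) (ℕ.m≤m⊔n N M))

small⇒≃0 : ∀ {x} → (∀ ε → 0ℚ ℚ.< ε → ∃[ N ] ∀ n → N ℕ.≤ n → ℚ.∣ seq x n ∣ ℚ.< ε) → x ≃ 0ᴿ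
small⇒≃0 small ε 0<ε with small ε 0<ε
... | N , close = N , λ n N≤n → ≡.subst (λ p → ℚ.∣ p ∣ ℚ.< ε) (≡.sym (-0-absorb _)) (close n N≤n)

-- Equality with 0 is a family of smallness claims; for each `ε` the alternative is apartness, which
-- contradicts the double negation.
≃0-stable : ∀ x → ¬ ¬ x ≃ 0ᴿ → x ≃ 0ᴿ
≃0-stable x ¬¬x≃0 = small⇒≃0 {x} λ ε 0<ε → case small-or-apart x ε 0<ε of λ
  { (inj₁ small) → small
  ; (inj₂ apart) → ⊥-elim (¬¬x≃0 (apart⇒≄0 {x} apart)) }

-- For each `ε` either `y` is small or it is apart from 0. In the latter case a bound `εδ` on the
-- product, with `δ` a lower bound for `∣ y ∣`, bounds `x` by `ε`, so `x` would be zero.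
*ᴿ-cancel : ∀ x y → x *ᴿ y ≃ 0ᴿ → ¬ x ≃ 0ᴿ → y ≃ 0ᴿ
*ᴿ-cancel x y xy≃0 x≄0 = small⇒≃0 {y} λ ε 0<ε → case small-or-apart y ε 0<ε of λ
  { (inj₁ small) → small
  ; (inj₂ apart) → ⊥-elim (x≄0 (small⇒≃0 {x} (x-small apart))) }
  where
  x-small : Apart₀ y → ∀ ε → 0ℚ ℚ.< ε → ∃[ N ] ∀ n → N ℕ.≤ n → ℚ.∣ seq x n ∣ ℚ.< ε
  x-small (δ , 0<δ , N , away) ε 0<ε = N ℕ.⊔ M , λ n N⊔M≤n → ℚ.≰⇒> λ ε≤∣x∣ →
    <⇒≱ (proj₂ (xy≃0 (ε ℚ.* δ) 0<εδ) n (ℕ.m⊔n≤o⇒n≤o N M N⊔M≤n)) (begin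
      ε ℚ.* δ                           ≤⟨ ℚ.*-monoʳ-≤-nonNeg δ {{ℚ.nonNegative (ℚ.<⇒≤ 0<δ)}} ε≤∣x∣ ⟩
      ℚ.∣ seq x n ∣ ℚ.* δ               ≤⟨ ℚ.*-monoˡ-≤-nonNeg ℚ.∣ seq x n ∣ {{ℚ.nonNegative (ℚ.0≤∣p∣ (seq x n))}}
                                             (away n (ℕ.m⊔n≤o⇒m≤o N M N⊔M≤n)) ⟩
      ℚ.∣ seq x n ∣ ℚ.* ℚ.∣ seq y n ∣   ≡⟨ ℚ.∣p*q∣≡∣p∣*∣q∣ (seq x n) (seq y n) ⟨
      ℚ.∣ seq x n ℚ.* seq y n ∣         ≡⟨ ≡.cong ℚ.∣_∣ (-0-absorb (seq x n ℚ.* seq y n)) ⟨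
      ℚ.∣ seq x n ℚ.* seq y n ℚ.- 0ℚ ∣  ∎)
    where
    open ℚ.≤-Reasoning
    0<εδ : 0ℚ ℚ.< ε ℚ.* δ
    0<εδ = ≡.subst (ℚ._< ε ℚ.* δ) (ℚ.*-zeroʳ ε) (ℚ.*-monoʳ-<-pos ε {{ℚ.positive 0<ε}} 0<δ)
    M = proj₁ (xy≃0 (ε ℚ.* δ) 0<εδ)

-- `_/_` reduces to lowest terms, so the sum is compared among unnormalised fractions, where the
-- denominator visibly stays 1.
suc/1 : ∀ n → + suc n ℚ./ 1 ≡ 1ℚ ℚ.+ (+ n ℚ./ 1)
suc/1 n = ℚ.toℚᵘ-injective (begin
  ℚ.toℚᵘ (+ suc n ℚ./ 1)               ≈⟨ ℚ.toℚᵘ-fromℚᵘ (ℚᵘ.mkℚᵘ (+ suc n) 0) ⟩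
  ℚᵘ.mkℚᵘ (+ suc n) 0                  ≈⟨ ℚᵘ.≃-reflexive (≡.cong (λ k → ℚᵘ.mkℚᵘ k 0) (≡.sym (≡.cong₂ ℤ._+_ (ℤ.*-identityʳ (+ 1)) (ℤ.*-identityʳ (+ n))))) ⟩
  ℚᵘ.1ℚᵘ ℚᵘ.+ ℚᵘ.mkℚᵘ (+ n) 0          ≈⟨ ℚᵘ.+-congʳ ℚᵘ.1ℚᵘ (ℚ.toℚᵘ-fromℚᵘ (ℚᵘ.mkℚᵘ (+ n) 0)) ⟨
  ℚᵘ.1ℚᵘ ℚᵘ.+ ℚ.toℚᵘ (+ n ℚ./ 1)       ≈⟨ ℚ.toℚᵘ-homo-+ 1ℚ (+ n ℚ./ 1) ⟨
  ℚ.toℚᵘ (1ℚ ℚ.+ (+ n ℚ./ 1))          ∎)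
  where open ℚᵘ.≃-Reasoning

seq-×1 : ∀ n k → seq (n ×ᴿ 1ᴿ) k ≡ + n ℚ./ 1
seq-×1 zero    k = ≡.refl
seq-×1 (suc n) k = ≡.trans (≡.cong (1ℚ ℚ.+_) (seq-×1 n k)) (≡.sym (suc/1 n))

1≤suc/1 : ∀ n → 1ℚ ℚ.≤ + suc n ℚ./ 1
1≤suc/1 n = begin
  1ℚ                       ≡⟨ ℚ.+-identityʳ 1ℚ ⟨
  1ℚ ℚ.+ 0ℚ                ≤⟨ ℚ.+-monoʳ-≤ 1ℚ (ℚ.nonNegative⁻¹ (+ n ℚ./ 1) {{ℚ.normalize-nonNeg n 1}}) ⟩
  1ℚ ℚ.+ (+ n ℚ./ 1)       ≡⟨ suc/1 n ⟨
  + suc n ℚ./ 1            ∎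
  where open ℚ.≤-Reasoning

1≤suc×1 : ∀ n k → 1ℚ ℚ.≤ seq (suc n ×ᴿ 1ᴿ) k
1≤suc×1 n k = ≡.subst (1ℚ ℚ.≤_) (≡.sym (seq-×1 (suc n) k)) (1≤suc/1 n)

0<1 : 0ℚ ℚ.< 1ℚ
0<1 = ℚ.positive⁻¹ 1ℚ

suc×1≄0 : ∀ n → ¬ suc n ×ᴿ 1ᴿ ≃ 0ᴿ
suc×1≄0 n = apart⇒≄0 {suc n ×ᴿ 1ᴿ} (1ℚ , 0<1 , 0 , λ k _ →
  ℚ.≤-trans (1≤suc×1 n k) (≤-∣-∣ _))

-- The threshold is one half because `suc n ×ᴿ 1ᴿ` is at least 1: it cannot be the sum of two terms
-- that are both below one half in absolute value.
0-or-suc×1-separate : ∀ n μ → ¬ μ ≃ 0ᴿ ⊎ ¬ (suc n ×ᴿ 1ᴿ) +ᴿ -ᴿ μ ≃ 0ᴿ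
0-or-suc×1-separate n μ with small-or-apart μ (½ ℚ.* 1ℚ) (halve 1ℚ 0<1)
... | inj₂ apart = inj₁ (apart⇒≄0 {μ} apart)
... | inj₁ (N , small) = inj₂ λ q-μ≃0 →
  let M , close = q-μ≃0 (½ ℚ.* 1ℚ) (halve 1ℚ 0<1)
      k = N ℕ.⊔ M
  in <⇒≱ (∣∣-split {q = seq μ k}
       (≡.subst (λ p → ℚ.∣ p ∣ ℚ.< ½ ℚ.* 1ℚ) (-0-absorb _) (close k (ℕ.m≤n⊔m N M)))
       (small k (ℕ.m≤m⊔n N M)))
     (ℚ.≤-trans (1≤suc×1 n k) (≤-∣-∣ _))

≃⇒≤ᴿ : ∀ {x y} → x ≃ y → x ≤ᴿ y
≃⇒≤ᴿ {x} {y} x≃y ε 0<ε with x≃y ε 0<ε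
... | N , close = N , λ n N≤n → begin-strict
  seq x n                             ≡⟨ -+-cancel (seq x n) (seq y n) ⟨
  (seq x n ℚ.- seq y n) ℚ.+ seq y n   <⟨ ℚ.+-monoˡ-< (seq y n) (ℚ.≤-<-trans (≤-∣-∣ _) (close n N≤n)) ⟩
  ε ℚ.+ seq y n                       ≡⟨ ℚ.+-comm ε (seq y n) ⟩
  seq y n ℚ.+ ε                       ∎
  where open ℚ.≤-Reasoning

≤ᴿ-trans : ∀ {x y z} → x ≤ᴿ y → y ≤ᴿ z → x ≤ᴿ z
≤ᴿ-trans {x} {y} {z} x≤y y≤z ε 0<ε with x≤y (½ ℚ.* ε) (halve ε 0<ε) | y≤z (½ ℚ.* ε) (halve ε 0<ε)
... | M , x<y | N , y<z = M ℕ.⊔ N , λ n M⊔N≤n → begin-strict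
  seq x n                               <⟨ x<y n (ℕ.m⊔n≤o⇒m≤o M N M⊔N≤n) ⟩
  seq y n ℚ.+ ½ ℚ.* ε                   <⟨ ℚ.+-monoˡ-< (½ ℚ.* ε) (y<z n (ℕ.m⊔n≤o⇒n≤o M N M⊔N≤n)) ⟩
  (seq z n ℚ.+ ½ ℚ.* ε) ℚ.+ ½ ℚ.* ε     ≡⟨ ℚ.+-assoc (seq z n) _ _ ⟩
  seq z n ℚ.+ (½ ℚ.* ε ℚ.+ ½ ℚ.* ε)     ≡⟨ ≡.cong (seq z n ℚ.+_) (halves ε) ⟩
  seq z n ℚ.+ ε                         ∎
  where open ℚ.≤-Reasoning

0≤suc×1 : ∀ n → 0ᴿ ≤ᴿ suc n ×ᴿ 1ᴿ
0≤suc×1 n ε 0<ε = 0 , λ k _ → ℚ.<-≤-trans 0<ε (begin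
  ε                            ≡⟨ ℚ.+-identityˡ ε ⟨
  0ℚ ℚ.+ ε                     ≤⟨ ℚ.+-monoˡ-≤ ε (ℚ.≤-trans (ℚ.<⇒≤ 0<1) (1≤suc×1 n k)) ⟩
  seq (suc n ×ᴿ 1ᴿ) k ℚ.+ ε    ∎)
  where open ℚ.≤-Reasoning

suc×1≰0 : ∀ n → ¬ suc n ×ᴿ 1ᴿ ≤ᴿ 0ᴿ
suc×1≰0 n q≤0 with q≤0 1ℚ 0<1
... | N , q<1 = <⇒≱ (q<1 N ℕ.≤-refl) (1≤suc×1 n N)

×1≃fromℕ : ∀ n → n ×ᴿ 1ᴿ ≃ fromℕ n
×1≃fromℕ n = ≗⇒≃ {n ×ᴿ 1ᴿ} {fromℕ n} (seq-×1 n)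

-- Finite subsets

∈─⁻ : ∀ {n} {x : Fin n} (p q : Subset n) → x ∈ p ─ q → x ∈ p × x ∉ q
∈─⁻ {x = zero}  (inside ∷ p) (outside ∷ q) Vec.here = Vec.here , λ ()
∈─⁻ {x = zero}  (_ ∷ p) (inside ∷ q) ()
∈─⁻ {x = suc x} (_ ∷ p) (_ ∷ q) (Vec.there x∈) with ∈─⁻ p q x∈
... | x∈p , x∉q = Vec.there x∈p , x∉q ∘ drop-there

∈-⁻ : ∀ {n} {x y : Fin n} (p : Subset n) → x ∈ p - y → x ∈ p × x ≢ y
∈-⁻ {y = y} p x∈ with ∈─⁻ p ⁅ y ⁆ x∈
... | x∈p , x∉ = x∈p , x∉⁅y⁆⇒x≢y x∉

∣p-x∣ : ∀ {n} {x : Fin n} {p : Subset n} → x ∈ p → suc ∣ p - x ∣ ≡ ∣ p ∣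
∣p-x∣ {x = zero} {inside ∷ p} Vec.here = ≡.cong (suc ∘ ∣_∣) (p─⊥≡p p)
∣p-x∣ {x = suc x} {inside  ∷ p} (Vec.there x∈p) = ≡.cong suc (∣p-x∣ x∈p)
∣p-x∣ {x = suc x} {outside ∷ p} (Vec.there x∈p) = ∣p-x∣ x∈p

∣p∪q∣+∣p∩q∣ : ∀ {n} (p q : Subset n) → ∣ p ∪ q ∣ ℕ.+ ∣ p ∩ q ∣ ≡ ∣ p ∣ ℕ.+ ∣ q ∣
∣p∪q∣+∣p∩q∣ [] [] = ≡.refl
∣p∪q∣+∣p∩q∣ (outside ∷ p) (outside ∷ q) = ∣p∪q∣+∣p∩q∣ p q
∣p∪q∣+∣p∩q∣ (outside ∷ p) (inside  ∷ q) = ≡.trans (≡.cong suc (∣p∪q∣+∣p∩q∣ p q)) (≡.sym (ℕ.+-suc _ _))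
∣p∪q∣+∣p∩q∣ (inside  ∷ p) (outside ∷ q) = ≡.cong suc (∣p∪q∣+∣p∩q∣ p q)
∣p∪q∣+∣p∩q∣ (inside  ∷ p) (inside  ∷ q) = ≡.cong suc
  (≡.trans (ℕ.+-suc _ _) (≡.trans (≡.cong suc (∣p∪q∣+∣p∩q∣ p q)) (≡.sym (ℕ.+-suc _ _))))

-‿injective : ∀ {n} {x y : Fin n} (p : Subset n) → x ∈ p → p - x ≡ p - y → x ≡ y
-‿injective {x = x} {y} p x∈p eq with x Fin.≟ y
... | yes x≡y = x≡y
... | no  x≢y = ⊥-elim (proj₂ (∈-⁻ p (≡.subst (x ∈_) (≡.sym eq) (x∈p∧x≢y⇒x∈p-y x∈p x≢y))) ≡.refl)

-- Counting yields a vertex `u` of `ρ` outside `σ`. Then `σ` lies in `ρ - u`, and a proper inclusion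
-- would contradict the equality of sizes.
facet⇒removal : ∀ {n} {σ ρ : Subset n} → σ ⊆ ρ → suc ∣ σ ∣ ≡ ∣ ρ ∣ → ∃[ u ] u ∈ ρ × σ ≡ ρ - u
facet⇒removal {σ = σ} {ρ} σ⊆ρ ∣σ∣ with Fin.any? (λ u → (u ∈? ρ) ×-dec ¬? (u ∈? σ))
... | no  none = ⊥-elim (ℕ.<⇒≱ (ℕ.≤-reflexive ∣σ∣) (p⊆q⇒∣p∣≤∣q∣ ρ⊆σ))
  where
  ρ⊆σ : ρ ⊆ σ
  ρ⊆σ {x} x∈ρ with x ∈? σ
  ... | yes x∈σ = x∈σ
  ... | no  x∉σ = ⊥-elim (none (x , x∈ρ , x∉σ))
... | yes (u , u∈ρ , u∉σ) = u , u∈ρ , ⊆-antisym σ⊆ ⊆σ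
  where
  σ⊆ : σ ⊆ ρ - u
  σ⊆ x∈σ = x∈p∧x≢y⇒x∈p-y (σ⊆ρ x∈σ) λ { ≡.refl → u∉σ x∈σ }
  ⊆σ : ρ - u ⊆ σ
  ⊆σ {x} x∈ with x ∈? σ
  ... | yes x∈σ = x∈σ
  ... | no  x∉σ = ⊥-elim (ℕ.<-irrefl (ℕ.suc-injective (≡.trans ∣σ∣ (≡.sym (∣p-x∣ u∈ρ))))
                    (p⊂q⇒∣p∣<∣q∣ (σ⊆ , x , x∈ , x∉σ)))

[p-x]∩[p-y] : ∀ {n} (p : Subset n) x y → (p - x) ∩ (p - y) ≡ p - x - y
[p-x]∩[p-y] p x y = ⊆-antisym
  (λ z∈ → let z∈p-x , z∈p-y = x∈p∩q⁻ (p - x) (p - y) z∈ in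
    x∈p∧x≢y⇒x∈p-y z∈p-x (proj₂ (∈-⁻ p z∈p-y)))
  (λ z∈ → let z∈p-x , z≢y = ∈-⁻ (p - x) z∈ in
    x∈p∩q⁺ (z∈p-x , x∈p∧x≢y⇒x∈p-y (proj₁ (∈-⁻ p z∈p-x)) z≢y))

[p-x]∪[p-y] : ∀ {n} (p : Subset n) {x y} → x ≢ y → (p - x) ∪ (p - y) ≡ p
[p-x]∪[p-y] p {x} {y} x≢y = ⊆-antisym
  (λ z∈ → [ proj₁ ∘ ∈-⁻ p , proj₁ ∘ ∈-⁻ p ]′ (x∈p∪q⁻ (p - x) (p - y) z∈))
  (λ {z} z∈p → x∈p∪q⁺ (case z Fin.≟ x of λ
    { (yes ≡.refl) → inj₂ (x∈p∧x≢y⇒x∈p-y z∈p x≢y)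
    ; (no  z≢x)    → inj₁ (x∈p∧x≢y⇒x∈p-y z∈p z≢x) }))

-- A bijection from `Fin k` to the members of `p`. It numbers the vertices of a coface, and it turns
-- inclusions of subsets into inequalities between cardinalities.
record Enumeration {n} (p : Subset n) (k : ℕ) : Set where
  field
    at        : Fin k → Fin n
    injective : ∀ {s t} → at s ≡ at t → s ≡ t
    at-∈      : ∀ t → at t ∈ p
    find      : ∀ {x} → x ∈ p → ∃[ t ] at t ≡ x

open Enumeration

enumerate : ∀ {n k} (p : Subset n) → ∣ p ∣ ≡ k → Enumeration p k
enumerate [] ≡.refl = record { at = λ () ; injective = λ {} ; at-∈ = λ () ; find = λ () }
enumerate (outside ∷ p) ≡.refl = record
  { at        = suc ∘ at e
  ; injective = injective e ∘ Fin.suc-injective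
  ; at-∈      = Vec.there ∘ at-∈ e
  ; find      = λ { (Vec.there x∈p) → Prod.map₂ (≡.cong suc) (find e x∈p) } }
  where e = enumerate p ≡.refl
enumerate (inside ∷ p) ≡.refl = record
  { at        = λ { zero → zero ; (suc t) → suc (at e t) }
  ; injective = λ { {zero} {zero} _ → ≡.refl
                  ; {suc s} {suc t} eq → ≡.cong suc (injective e (Fin.suc-injective eq)) }
  ; at-∈      = λ { zero → Vec.here ; (suc t) → Vec.there (at-∈ e t) }
  ; find      = λ { Vec.here → zero , ≡.refl
                  ; (Vec.there x∈p) → Prod.map suc (≡.cong suc) (find e x∈p) } }
  where e = enumerate p ≡.refl

enumeration-≤ : ∀ {n k l} {p q : Subset n} → Enumeration p k → Enumeration q l → p ⊆ q → k ℕ.≤ l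
enumeration-≤ e e′ p⊆q = Fin.injective⇒≤ {f = λ t → proj₁ (find e′ (p⊆q (at-∈ e t)))} λ {s} {t} eq →
  injective e (≡.trans (≡.sym (proj₂ (find e′ (p⊆q (at-∈ e s)))))
    (≡.trans (≡.cong (at e′) eq) (proj₂ (find e′ (p⊆q (at-∈ e t))))))

enumeration⇒∣p∣ : ∀ {n k} {p : Subset n} → Enumeration p k → ∣ p ∣ ≡ k
enumeration⇒∣p∣ {p = p} e = ℕ.≤-antisym
  (enumeration-≤ (enumerate p ≡.refl) e λ x∈p → x∈p)
  (enumeration-≤ e (enumerate p ≡.refl) λ x∈p → x∈p)

subsetOf : ∀ {n} {P : Pred (Fin n) 0ℓ} → Decidable P → Subset n
subsetOf P? = Vec.tabulate (does ∘ P?)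

∈-subsetOf⁺ : ∀ {n} {P : Pred (Fin n) 0ℓ} (P? : Decidable P) {x} → P x → x ∈ subsetOf P?
∈-subsetOf⁺ P? {x} px = Vec.lookup⇒[]= x _ (≡.trans (Vec.lookup∘tabulate _ x) (dec-true (P? x) px))

∈-subsetOf⁻ : ∀ {n} {P : Pred (Fin n) 0ℓ} (P? : Decidable P) {x} → x ∈ subsetOf P? → P x
∈-subsetOf⁻ P? {x} x∈ with P? x | ≡.trans (≡.sym (Vec.lookup∘tabulate (does ∘ P?) x)) (Vec.[]=⇒lookup x∈)
... | yes px | _ = px

-- Filtered lists

module _ {A : Set} where

  lookup-injective : ∀ {xs : List A} → Unique xs → ∀ {i j} → lookup xs i ≡ lookup xs j → i ≡ j
  lookup-injective (_ ∷ _)    {zero}  {zero}  _  = ≡.refl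
  lookup-injective (x∉xs ∷ _) {zero}  {suc j} eq = ⊥-elim (All.lookup x∉xs (List.∈-lookup j) eq)
  lookup-injective (x∉xs ∷ _) {suc i} {zero}  eq = ⊥-elim (All.lookup x∉xs (List.∈-lookup i) (≡.sym eq))
  lookup-injective (_ ∷ xs!)  {suc i} {suc j} eq = ≡.cong suc (lookup-injective xs! eq)

  unique-singleton : ∀ {x : A} {xs} → Unique xs → x List.∈ xs → (∀ {y} → y List.∈ xs → y ≡ x) → length xs ≡ 1
  unique-singleton {xs = _ ∷ []}    _ _ _ = ≡.refl
  unique-singleton {xs = y ∷ z ∷ _} ((y≢z ∷ _) ∷ _) _ all≡x =
    ⊥-elim (y≢z (≡.trans (all≡x (here ≡.refl)) (≡.sym (all≡x (there (here ≡.refl))))))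

  length-filter-unique : ∀ {P : Pred A 0ℓ} (P? : Decidable P) {x xs} → Unique xs → x List.∈ xs → P x →
    (∀ {y} → y List.∈ xs → P y → y ≡ x) → length (filter P? xs) ≡ 1
  length-filter-unique P? xs! x∈xs px only-x = unique-singleton (Unique.filter⁺ P? xs!)
    (List.∈-filter⁺ P? x∈xs px) (Prod.uncurry only-x ∘ List.∈-filter⁻ P?)

  length-filter-⊎ : ∀ {P Q R : Pred A 0ℓ} (P? : Decidable P) (Q? : Decidable Q) (R? : Decidable R) →
    (∀ {x} → P x → Q x ⊎ R x) → (∀ {x} → Q x → P x) → (∀ {x} → R x → P x) → (∀ {x} → Q x → ¬ R x) →
    ∀ xs → length (filter P? xs) ≡ length (filter R? xs) ℕ.+ length (filter Q? xs)
  length-filter-⊎ P? Q? R? split Q⇒P R⇒P disjoint [] = ≡.refl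
  length-filter-⊎ P? Q? R? split Q⇒P R⇒P disjoint (x ∷ xs)
    with ih ← length-filter-⊎ P? Q? R? split Q⇒P R⇒P disjoint xs | P? x | Q? x | R? x
  ... | _      | yes qx | yes rx = ⊥-elim (disjoint qx rx)
  ... | yes _  | yes _  | no _   = ≡.trans (≡.cong suc ih) (≡.sym (ℕ.+-suc _ _))
  ... | yes _  | no _   | yes _  = ≡.cong suc ih
  ... | yes px | no ¬qx | no ¬rx = ⊥-elim ([ ¬qx , ¬rx ]′ (split px))
  ... | no ¬px | yes qx | _      = ⊥-elim (¬px (Q⇒P qx))
  ... | no ¬px | _      | yes rx = ⊥-elim (¬px (R⇒P rx))
  ... | no _   | no _   | no _   = ih

-- Faces

∈-allSubsets : ∀ {N} (σ : Subset N) → σ List.∈ allSubsets N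
∈-allSubsets []            = here ≡.refl
∈-allSubsets (outside ∷ σ) = List.∈-++⁺ˡ (List.∈-map⁺ (outside ∷_) (∈-allSubsets σ))
∈-allSubsets (inside  ∷ σ) = List.∈-++⁺ʳ _ (List.∈-map⁺ (inside ∷_) (∈-allSubsets σ))

allSubsets-unique : ∀ N → Unique (allSubsets N)
allSubsets-unique zero    = [] ∷ []
allSubsets-unique (suc N) = Unique.++⁺
  (Unique.map⁺ Vec.∷-injectiveʳ (allSubsets-unique N))
  (Unique.map⁺ Vec.∷-injectiveʳ (allSubsets-unique N))
  λ (σ∈out , σ∈in) → case List.∈-map⁻ _ σ∈out , List.∈-map⁻ _ σ∈in of λ
    { ((_ , _ , ≡.refl) , (_ , _ , ())) }

module _ {N : ℕ} (X : SimplicialComplex N) where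

  faces-unique : ∀ s → Unique (faces X s)
  faces-unique s = Unique.filter⁺ (isFace? X s) (allSubsets-unique N)

  ∈-faces : ∀ {s σ} → IsFace X s σ → σ List.∈ faces X s
  ∈-faces {s} {σ} = List.∈-filter⁺ (isFace? X s) (∈-allSubsets σ)

  faces-∈ : ∀ {s σ} → σ List.∈ faces X s → IsFace X s σ
  faces-∈ {s} σ∈ = proj₂ (List.∈-filter⁻ (isFace? X s) {xs = allSubsets N} σ∈)

  face : ∀ s → Fin (f X s) → Subset N
  face s = lookup (faces X s)

  face-isFace : ∀ s i → IsFace X s (face s i)
  face-isFace s i = faces-∈ (List.∈-lookup i)

  face-injective : ∀ s {i j} → face s i ≡ face s j → i ≡ j
  face-injective s = lookup-injective (faces-unique s)

  index : ∀ {s σ} → IsFace X s σ → Fin (f X s)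
  index σ-face = Any.index (∈-faces σ-face)

  face-index : ∀ {s σ} (σ-face : IsFace X s σ) → face s (index σ-face) ≡ σ
  face-index σ-face = ≡.sym (Any.lookup-index (∈-faces σ-face))

-- Incidence signs

if-yes : ∀ {A P : Set} (P? : Dec P) {x y : A} → P → (if does P? then x else y) ≡ x
if-yes P? p rewrite dec-true P? p = ≡.refl

if-no : ∀ {A P : Set} (P? : Dec P) {x y : A} → ¬ P → (if does P? then x else y) ≡ y
if-no P? ¬p rewrite dec-false P? ¬p = ≡.refl

IsSign : ℤ → Set
IsSign z = z ≡ 1ℤ ⊎ z ≡ -1ℤ

-1^-isSign : ∀ k → IsSign (-1ℤ ℤ.^ k)
-1^-isSign zero = inj₁ ≡.refl
-1^-isSign (suc k) with -1ℤ ℤ.^ k | -1^-isSign k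
... | _ | inj₁ ≡.refl = inj₂ ≡.refl
... | _ | inj₂ ≡.refl = inj₁ ≡.refl

IsSign-square : ∀ {z} → IsSign z → z ℤ.* z ≡ 1ℤ
IsSign-square (inj₁ ≡.refl) = ≡.refl
IsSign-square (inj₂ ≡.refl) = ≡.refl

module _ {N : ℕ} {_≺_ : Rel (Fin N) 0ℓ} (≺-sto : IsStrictTotalOrder _≡_ _≺_) where
  open IsStrictTotalOrder ≺-sto using (compare) renaming (_<?_ to _≺?_)

  before : Subset N → Fin N → ℕ
  before ρ u = length (filter (λ v → (v ∈? ρ) ×-dec (v ≺? u)) (allFin N))

  -- When `u` is the only element of `τ ─ σ`, the existential inside `incidence` collapses to the
  -- comparison with `u`.
  incidence-before : ∀ {τ σ u} → u ∈ τ ─ σ → (∀ {x} → x ∈ τ ─ σ → x ≡ u) →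
    incidence ≺-sto τ σ ≡ -1ℤ ℤ.^ before τ u
  incidence-before u∈ only-u = ≡.cong (λ vs → -1ℤ ℤ.^ length vs) (List.filter-≐ _ _
    ( (λ { (v∈τ , u′ , u′∈ , v≺u′) → v∈τ , ≡.subst (_ ≺_) (only-u u′∈) v≺u′ })
    , (λ { (v∈τ , v≺u) → v∈τ , _ , u∈ , v≺u })) (allFin N))

  incidence-removal : ∀ {ρ u} → u ∈ ρ → incidence ≺-sto ρ (ρ - u) ≡ -1ℤ ℤ.^ before ρ u
  incidence-removal {ρ} {u} u∈ρ = incidence-before
    (x∈p∧x∉q⇒x∈p─q u∈ρ λ u∈ → proj₂ (∈-⁻ ρ u∈) ≡.refl)
    λ {x} x∈ → let x∈ρ , x∉ρ-u = ∈─⁻ ρ (ρ - u) x∈ in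
      case x Fin.≟ u of λ
        { (yes x≡u) → x≡u
        ; (no  x≢u) → ⊥-elim (x∉ρ-u (x∈p∧x≢y⇒x∈p-y x∈ρ x≢u)) }

  before-removal-≺ : ∀ {ρ u v} → v ∈ ρ → v ≺ u → before ρ u ≡ suc (before (ρ - v) u)
  before-removal-≺ {ρ} {u} {v} v∈ρ v≺u = ≡.trans
    (length-filter-⊎ (λ x → (x ∈? ρ) ×-dec (x ≺? u)) (λ x → (x ∈? (ρ - v)) ×-dec (x ≺? u)) (Fin._≟ v)
      (λ {x} (x∈ρ , x≺u) → case x Fin.≟ v of λ
        { (yes x≡v) → inj₂ x≡v
        ; (no  x≢v) → inj₁ (x∈p∧x≢y⇒x∈p-y x∈ρ x≢v , x≺u) })
      (λ (x∈ , x≺u) → proj₁ (∈-⁻ ρ x∈) , x≺u)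
      (λ { ≡.refl → v∈ρ , v≺u })
      (λ (x∈ , _) x≡v → proj₂ (∈-⁻ ρ x∈) x≡v)
      (allFin N))
    (≡.cong (ℕ._+ before (ρ - v) u)
      (length-filter-unique (Fin._≟ v) (Unique.allFin⁺ N) (List.∈-allFin v) ≡.refl λ _ x≡v → x≡v))

  before-removal-⊀ : ∀ {ρ u v} → ¬ v ≺ u → before ρ u ≡ before (ρ - v) u
  before-removal-⊀ {ρ} v⊀u = ≡.cong length (List.filter-≐ _ _
    ( (λ { (x∈ρ , x≺u) → x∈p∧x≢y⇒x∈p-y x∈ρ (λ { ≡.refl → v⊀u x≺u }) , x≺u })
    , (λ { (x∈ , x≺u) → proj₁ (∈-⁻ ρ x∈) , x≺u })) (allFin N))

  -- The square of the simplicial boundary operator vanishes.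
  signs-anticommute : ∀ {ρ u v} → u ∈ ρ → v ∈ ρ → u ≢ v →
    ℤ.- (-1ℤ ℤ.^ before (ρ - u) v ℤ.* -1ℤ ℤ.^ before (ρ - v) u) ≡
    -1ℤ ℤ.^ before ρ u ℤ.* -1ℤ ℤ.^ before ρ v
  signs-anticommute {ρ} {u} {v} u∈ρ v∈ρ u≢v with compare u v
  ... | tri≈ _ u≡v _ = ⊥-elim (u≢v u≡v)
  -- Deleting the smaller vertex lowers the position of the larger by one, while deleting the larger
  -- leaves the smaller in place; this single shift is the extra sign.
  ... | tri< u≺v _ v⊀u rewrite before-removal-≺ u∈ρ u≺v | before-removal-⊀ {ρ} v⊀u =
    flip (-1ℤ ℤ.^ before (ρ - u) v) (-1ℤ ℤ.^ before (ρ - v) u)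
    where
    flip : ∀ a b → ℤ.- (a ℤ.* b) ≡ b ℤ.* (-1ℤ ℤ.* a)
    flip a b = ≡.trans (≡.cong ℤ.-_ (ℤ.*-comm a b))
      (≡.trans (ℤ.neg-distribʳ-* b a) (≡.cong (b ℤ.*_) (≡.sym (ℤ.-1*i≡-i a))))
  ... | tri> u⊀v _ v≺u rewrite before-removal-≺ v∈ρ v≺u | before-removal-⊀ {ρ} u⊀v =
    flip (-1ℤ ℤ.^ before (ρ - u) v) (-1ℤ ℤ.^ before (ρ - v) u)
    where
    flip : ∀ a b → ℤ.- (a ℤ.* b) ≡ -1ℤ ℤ.* b ℤ.* a
    flip a b = ≡.trans (ℤ.neg-distribʳ-* a b) (≡.trans (≡.cong (a ℤ.*_) (≡.sym (ℤ.-1*i≡-i b))) (ℤ.*-comm a _))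

  module _ (X : SimplicialComplex N) (r : ℕ) where

    -- The two facets meet in `ρ - u - v` and have union `ρ`, so the entry takes its signed branch;
    -- anticommutation trades the signs towards the intersection for the signs from `ρ`.
    entry-same-coface : ∀ {ρ u v} → IsFace X (suc r) ρ → u ∈ ρ → v ∈ ρ → u ≢ v →
      upperLaplacianEntry ≺-sto X r (ρ - u) (ρ - v) ≡
      incidence ≺-sto ρ (ρ - u) ℤ.* incidence ≺-sto ρ (ρ - v)
    entry-same-coface {ρ} {u} {v} (ρ∈X , ∣ρ∣) u∈ρ v∈ρ u≢v = ≡.trans
      (if-yes ((suc ∣ (ρ - u) ∩ (ρ - v) ∣ ℕ.≟ r) ×-dec simplex? X ((ρ - u) ∪ (ρ - v)))
        ( ≡.trans (≡.cong (suc ∘ ∣_∣) ([p-x]∩[p-y] ρ u v))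
            (≡.trans (∣p-x∣ v∈ρ-u) (ℕ.suc-injective (≡.trans (∣p-x∣ u∈ρ) ∣ρ∣)))
        , ≡.subst (Simplex X) (≡.sym ([p-x]∪[p-y] ρ u≢v)) ρ∈X))
      (≡.trans
        (≡.cong₂ (λ a b → ℤ.- (a ℤ.* b))
          (≡.trans (≡.cong (incidence ≺-sto (ρ - u)) ([p-x]∩[p-y] ρ u v)) (incidence-removal v∈ρ-u))
          (≡.trans (≡.cong (incidence ≺-sto (ρ - v)) (≡.trans ([p-x]∩[p-y] ρ u v) (p─x─y≡p─y─x ρ u v)))
            (incidence-removal u∈ρ-v)))
        (≡.trans (signs-anticommute u∈ρ v∈ρ u≢v)
          (≡.sym (≡.cong₂ ℤ._*_ (incidence-removal u∈ρ) (incidence-removal v∈ρ)))))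
      where
      v∈ρ-u : v ∈ ρ - u
      v∈ρ-u = x∈p∧x≢y⇒x∈p-y v∈ρ (u≢v ∘ ≡.sym)
      u∈ρ-v : u ∈ ρ - v
      u∈ρ-v = x∈p∧x≢y⇒x∈p-y u∈ρ u≢v

    -- A signed entry would need `σ ∪ τ` to be a simplex with `∣ σ ∩ τ ∣` one less than `r`;
    -- inclusion-exclusion then gives it `suc r` vertices, making it a common coface.
    entry-no-coface : ∀ {σ τ} → IsFace X r σ → IsFace X r τ →
      ¬ (∃[ ρ ] IsFace X (suc r) ρ × σ ⊆ ρ × τ ⊆ ρ) →
      upperLaplacianEntry ≺-sto X r σ τ ≡ 0ℤ
    entry-no-coface {σ} {τ} (_ , ∣σ∣) (_ , ∣τ∣) none = if-no
      ((suc ∣ σ ∩ τ ∣ ℕ.≟ r) ×-dec simplex? X (σ ∪ τ))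
      λ (∣σ∩τ∣ , σ∪τ∈X) → none (σ ∪ τ , (σ∪τ∈X , ∣σ∪τ∣ ∣σ∩τ∣) , p⊆p∪q τ , q⊆p∪q σ τ)
      where
      ∣σ∪τ∣ : suc ∣ σ ∩ τ ∣ ≡ r → ∣ σ ∪ τ ∣ ≡ suc r
      ∣σ∪τ∣ ∣σ∩τ∣ = ℕ.+-cancelʳ-≡ ∣ σ ∩ τ ∣ _ _ (≡.trans (∣p∪q∣+∣p∩q∣ σ τ)
        (≡.trans (≡.cong₂ ℕ._+_ ∣σ∣ (≡.trans ∣τ∣ (≡.sym ∣σ∩τ∣))) (ℕ.+-suc r ∣ σ ∩ τ ∣)))

-- Faces sorted into blocks by their unique coface

module UniqueCoface {N : ℕ} (X : SimplicialComplex N) (r : ℕ)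
  (unique-coface : ∀ σ → IsFace X r σ → ∃! _≡_ (λ τ → IsFace X (suc r) τ × σ ⊆ τ)) where

  n m : ℕ
  n = f X r
  m = f X (suc r)

  σ : Fin n → Subset N
  σ = face X r

  ρ : Fin m → Subset N
  ρ = face X (suc r)

  vertices : ∀ t → Enumeration (ρ t) (suc r)
  vertices t = enumerate (ρ t) (proj₂ (face-isFace X (suc r) t))

  facet : Fin m × Fin (suc r) → Subset N
  facet (t , s) = ρ t - at (vertices t) s

  facet⊆ρ : ∀ t s → facet (t , s) ⊆ ρ t
  facet⊆ρ t s x∈ = proj₁ (∈-⁻ (ρ t) x∈)

  facet-isFace : ∀ ts → IsFace X r (facet ts)
  facet-isFace (t , s) = down-closed X (facet⊆ρ t s) (proj₁ (face-isFace X (suc r) t)) ,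
    ℕ.suc-injective (≡.trans (∣p-x∣ (at-∈ (vertices t) s)) (proj₂ (face-isFace X (suc r) t)))

  coface : Fin n → Fin m
  coface i = index X (proj₁ (proj₁ (proj₂ (unique-coface (σ i) (face-isFace X r i)))))

  σ⊆coface : ∀ i → σ i ⊆ ρ (coface i)
  σ⊆coface i = ≡.subst (σ i ⊆_) (≡.sym (face-index X _))
    (proj₂ (proj₁ (proj₂ (unique-coface (σ i) (face-isFace X r i)))))

  ⊆⇒coface : ∀ {i τ} → IsFace X (suc r) τ → σ i ⊆ τ → ρ (coface i) ≡ τ
  ⊆⇒coface {i} τ-face σ⊆τ = ≡.trans (face-index X _)
    (proj₂ (proj₂ (unique-coface (σ i) (face-isFace X r i))) (τ-face , σ⊆τ))

  removal : ∀ i → ∃[ s ] σ i ≡ facet (coface i , s)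
  removal i =
    let u , u∈ρ , σ≡ = facet⇒removal (σ⊆coface i)
          (≡.trans (≡.cong suc (proj₂ (face-isFace X r i))) (≡.sym (proj₂ (face-isFace X (suc r) (coface i)))))
        s , at-s≡u = find (vertices (coface i)) u∈ρ
    in s , ≡.trans σ≡ (≡.cong (ρ (coface i) -_) (≡.sym at-s≡u))

  place : Fin n → Fin (suc r)
  place i = proj₁ (removal i)

  σ≡facet : ∀ i → σ i ≡ facet (coface i , place i)
  σ≡facet i = proj₂ (removal i)

  facet-place-injective : ∀ {t t′ s s′} → t ≡ t′ → facet (t , s) ≡ facet (t′ , s′) → (t , s) ≡ (t′ , s′)
  facet-place-injective {t} ≡.refl eq = ≡.cong (t ,_)
    (injective (vertices t) (-‿injective (ρ t) (at-∈ (vertices t) _) eq))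

  partition : Fin n ↔ (Fin m × Fin (suc r))
  partition = mk↔ₛ′ to from to∘from from∘to
    where
    to : Fin n → Fin m × Fin (suc r)
    to i = coface i , place i
    from : Fin m × Fin (suc r) → Fin n
    from ts = index X (facet-isFace ts)
    σ-from : ∀ ts → σ (from ts) ≡ facet ts
    σ-from ts = face-index X (facet-isFace ts)
    to∘from : ∀ ts → to (from ts) ≡ ts
    -- Since `ρ t` contains the facet, uniqueness makes it the chosen coface; places become
    -- comparable only after this, as they number the vertices of one coface.
    to∘from (t , s) = facet-place-injective
      (face-injective X (suc r) (⊆⇒coface (face-isFace X (suc r) t)
        (facet⊆ρ t s ∘ ≡.subst (_ ∈_) (σ-from (t , s)))))
      (≡.trans (≡.sym (σ≡facet (from (t , s)))) (σ-from (t , s)))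
    from∘to : ∀ i → from (to i) ≡ i
    from∘to i = face-injective X r (≡.trans (σ-from (to i)) (≡.sym (σ≡facet i)))

  deg≡1 : ∀ {τ} → IsFace X r τ → deg X r τ ≡ 1
  deg≡1 {τ} τ-face =
    let c , (c-face , τ⊆c) , c-unique = unique-coface τ τ-face
    in length-filter-unique (τ ⊆?_) (faces-unique X (suc r)) (∈-faces X c-face) τ⊆c
         λ y∈ τ⊆y → ≡.sym (c-unique (faces-∈ X y∈ , τ⊆y))

  module _ {_≺_ : Rel (Fin N) 0ℓ} (≺-sto : IsStrictTotalOrder _≡_ _≺_) where

    sign : Fin n → ℤ
    sign i = incidence ≺-sto (ρ (coface i)) (σ i)

    sign-isSign : ∀ i → IsSign (sign i)
    sign-isSign i = -1^-isSign (length (filter _ (allFin N)))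

    laplacian-entry : ∀ i j →
      (if does (i Fin.≟ j) then + deg X r (σ i) else upperLaplacianEntry ≺-sto X r (σ i) (σ j)) ≡
      (if does (coface i Fin.≟ coface j) then sign i ℤ.* sign j else 0ℤ)
    laplacian-entry i j = decide (i Fin.≟ j) (coface i Fin.≟ coface j)
      where
      -- Generalised to variable indices so that the equation between cofaces can be eliminated by
      -- matching.
      same-coface : ∀ {t t′ s s′} → t ≡ t′ → facet (t , s) ≢ facet (t′ , s′) →
        upperLaplacianEntry ≺-sto X r (facet (t , s)) (facet (t′ , s′)) ≡
        incidence ≺-sto (ρ t) (facet (t , s)) ℤ.* incidence ≺-sto (ρ t′) (facet (t′ , s′))
      same-coface {t} ≡.refl facets≢ = entry-same-coface ≺-sto X r (face-isFace X (suc r) t)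
        (at-∈ (vertices t) _) (at-∈ (vertices t) _) (facets≢ ∘ ≡.cong (ρ t -_))

      decide : (i≟j : Dec (i ≡ j)) (c≟ : Dec (coface i ≡ coface j)) →
        (if does i≟j then + deg X r (σ i) else upperLaplacianEntry ≺-sto X r (σ i) (σ j)) ≡
        (if does c≟ then sign i ℤ.* sign j else 0ℤ)
      decide (yes ≡.refl) (no c≢) = ⊥-elim (c≢ ≡.refl)
      -- The diagonal fits the rank-one pattern because the degree 1 is the square of a sign.
      decide (yes ≡.refl) (yes _) =
        ≡.trans (≡.cong +_ (deg≡1 (face-isFace X r i))) (≡.sym (IsSign-square (sign-isSign i)))
      decide (no i≢j) (no c≢) = entry-no-coface ≺-sto X r (face-isFace X r i) (face-isFace X r j)
        λ (τ , τ-face , σi⊆τ , σj⊆τ) →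
          c≢ (face-injective X (suc r) (≡.trans (⊆⇒coface τ-face σi⊆τ) (≡.sym (⊆⇒coface τ-face σj⊆τ))))
      decide (no i≢j) (yes c≡) = ≡.subst₂ (λ a b → upperLaplacianEntry ≺-sto X r a b ≡
          incidence ≺-sto (ρ (coface i)) a ℤ.* incidence ≺-sto (ρ (coface j)) b)
        (≡.sym (σ≡facet i)) (≡.sym (σ≡facet j))
        (same-coface c≡ λ eq → i≢j (face-injective X r (≡.trans (σ≡facet i) (≡.trans eq (≡.sym (σ≡facet j))))))

-- Cardinalities

below : ∀ {n} → ℕ → Subset n
below l = subsetOf (λ i → toℕ i ℕ.<? l)

enumerate-below : ∀ {n l} → l ≤ n → Enumeration (below {n} l) l
enumerate-below {n} {l} l≤n = record
  { at        = λ t → Fin.inject≤ t l≤n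
  ; injective = Fin.inject≤-injective l≤n l≤n _ _
  ; at-∈      = λ t → ∈-subsetOf⁺ (λ i → toℕ i ℕ.<? l)
                  (≡.subst (_< l) (≡.sym (Fin.toℕ-inject≤ t l≤n)) (Fin.toℕ<n t))
  ; find      = λ {x} x∈ → let x<l = ∈-subsetOf⁻ (λ i → toℕ i ℕ.<? l) x∈ in
                  Fin.fromℕ< x<l , Fin.toℕ-injective
                    (≡.trans (Fin.toℕ-inject≤ _ l≤n) (Fin.toℕ-fromℕ< x<l)) }

∣below∣ : ∀ {n l} → l ≤ n → ∣ below {n} l ∣ ≡ l
∣below∣ l≤n = enumeration⇒∣p∣ (enumerate-below l≤n)

HasCardinality-map : ∀ {n d} {P Q : Pred (Fin n) 0ℓ} →
  (∀ {i} → P i → Q i) → (∀ {i} → Q i → P i) → HasCardinality P d → HasCardinality Q d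
HasCardinality-map P⇒Q Q⇒P (S , S⇔P , ∣S∣) =
  S , (λ i → mk⇔ (P⇒Q ∘ Equivalence.to (S⇔P i)) (Equivalence.from (S⇔P i) ∘ Q⇒P)) , ∣S∣

HasCardinality-unique : ∀ {n d e} {P : Pred (Fin n) 0ℓ} →
  HasCardinality P d → HasCardinality P e → d ≡ e
HasCardinality-unique (S , S⇔P , ≡.refl) (T , T⇔P , ≡.refl) = ≡.cong ∣_∣ (⊆-antisym
  (λ {i} → Equivalence.from (T⇔P i) ∘ Equivalence.to (S⇔P i))
  (λ {i} → Equivalence.from (S⇔P i) ∘ Equivalence.to (T⇔P i)))

HasCardinality-0 : ∀ {n} {P : Pred (Fin n) 0ℓ} → (∀ i → ¬ P i) → HasCardinality P 0
HasCardinality-0 {n} none =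
  ⊥ , (λ i → mk⇔ (⊥-elim ∘ ∉⊥) (⊥-elim ∘ none i)) , ∣⊥∣≡0 n

HasCardinality-dichotomy : ∀ {n d} {P : Pred (Fin n) 0ℓ} → HasCardinality P d → ∃ P ⊎ d ≡ 0
HasCardinality-dichotomy {n} (S , S⇔P , ≡.refl) with nonempty? S
... | yes (i , i∈S) = inj₁ (i , Equivalence.to (S⇔P i) i∈S)
... | no  empty     = inj₂ (≡.trans (≡.cong ∣_∣ (Empty-unique empty)) (∣⊥∣≡0 n))

-- If `i` satisfied neither predicate, `T` would be a proper subset of the complement of `S`,
-- although both have size `e`.
complementary : ∀ {n d e} {P Q : Pred (Fin n) 0ℓ} → HasCardinality P d → HasCardinality Q e →
  n ≡ d + e → (∀ {i} → P i → ¬ Q i) → ∀ i → P i ⊎ Q i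
complementary {n} (S , S⇔P , ≡.refl) (T , T⇔Q , ≡.refl) n≡ disjoint i with i ∈? S | i ∈? T
... | yes i∈S | _ = inj₁ (Equivalence.to (S⇔P i) i∈S)
... | no _ | yes i∈T = inj₂ (Equivalence.to (T⇔Q i) i∈T)
... | no i∉S | no i∉T = ⊥-elim (ℕ.<-irrefl
  (≡.sym (≡.trans (∣∁p∣≡n∸∣p∣ S) (≡.trans (≡.cong (ℕ._∸ ∣ S ∣) n≡) (ℕ.m+n∸m≡n ∣ S ∣ ∣ T ∣))))
  (p⊂q⇒∣p∣<∣q∣ (T⊆∁S , i , x∉p⇒x∈∁p i∉S , i∉T)))
  where
  T⊆∁S : T ⊆ ∁ S
  T⊆∁S {j} j∈T = x∉p⇒x∈∁p λ j∈S →
    disjoint (Equivalence.to (S⇔P j) j∈S) (Equivalence.to (T⇔Q j) j∈T)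

sum-take-ones : ∀ {xs} j → j ≤ length xs → All (_≡ 1) xs → sum (take j xs) ≡ j
sum-take-ones zero    _         _                  = ≡.refl
sum-take-ones (suc j) (s≤s j≤) (≡.refl ∷ all-ones) = ≡.cong suc (sum-take-ones j j≤ all-ones)

sumFirst-constant : ∀ {n} k {x} (ev : Vector ℝ n) → k ≤ n → (∀ i → toℕ i < k → ev i ≃ x) →
  sumFirst k ev ≃ k ×ᴿ x
sumFirst-constant zero ev _ _ = ≃-refl {0ᴿ}
sumFirst-constant (suc k) {x} ev (s≤s k≤n) constant =
  +ᴿ-cong {ev zero} {x} {sumFirst k (ev ∘ suc)} {k ×ᴿ x} (constant zero (s≤s z≤n))
    (sumFirst-constant k (ev ∘ suc) k≤n λ i i<k → constant (suc i) (s≤s i<k))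

-- Eigenvalues

-- Only the integers 0, 1 and -1 occur, so every case is a closed computation with rationals.
fromℤ-sign-entry : ∀ b {x y} → IsSign x → IsSign y → ∀ k →
  seq (fromℤ (if b then x ℤ.* y else 0ℤ)) k ≡
  seq ((if b then 1ᴿ else 0ᴿ) *ᴿ (fromℤ x *ᴿ fromℤ y)) k
fromℤ-sign-entry false (inj₁ ≡.refl) (inj₁ ≡.refl) _ = ≡.refl
fromℤ-sign-entry false (inj₁ ≡.refl) (inj₂ ≡.refl) _ = ≡.refl
fromℤ-sign-entry false (inj₂ ≡.refl) (inj₁ ≡.refl) _ = ≡.refl
fromℤ-sign-entry false (inj₂ ≡.refl) (inj₂ ≡.refl) _ = ≡.refl
fromℤ-sign-entry true  (inj₁ ≡.refl) (inj₁ ≡.refl) _ = ≡.refl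
fromℤ-sign-entry true  (inj₁ ≡.refl) (inj₂ ≡.refl) _ = ≡.refl
fromℤ-sign-entry true  (inj₂ ≡.refl) (inj₁ ≡.refl) _ = ≡.refl
fromℤ-sign-entry true  (inj₂ ≡.refl) (inj₂ ≡.refl) _ = ≡.refl

fromℤ-sign-square : ∀ {x} → IsSign x → ∀ k → seq (fromℤ x *ᴿ fromℤ x) k ≡ seq 1ᴿ k
fromℤ-sign-square (inj₁ ≡.refl) _ = ≡.refl
fromℤ-sign-square (inj₂ ≡.refl) _ = ≡.refl

open FreeModule ℝ-commutativeRing
  using (module SignedPartition; δ; HasBasis; HasBasis-resp; dimension-unique)

-- Eigenvalue lists of the block matrix over the reals

module Spectrum {n m r : ℕ}
  (partition : Fin n ↔ (Fin m × Fin (suc r)))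
  (w : Fin n → ℝ) (w² : ∀ i → w i *ᴿ w i ≃ 1ᴿ)
  (L : Matrix n)
  (L-entry : ∀ i j → L i j ≃
    δ (proj₁ (Inverse.to partition i)) (proj₁ (Inverse.to partition j)) *ᴿ (w i *ᴿ w j))
  where

  module SP = SignedPartition partition w w² L L-entry

  q : ℝ
  q = suc r ×ᴿ 1ᴿ

  q-eigenspace : HasDimension (Eigenspace L q) m
  q-eigenspace = SP.q-eigenspace *ᴿ-cancel suc×1≄0

  0-eigenspace : HasDimension (Eigenspace L 0ᴿ) (m * r)
  0-eigenspace = SP.0-eigenspace *ᴿ-cancel suc×1≄0

  basis⇒eigenvalue : ∀ {μ d} → HasDimension (Eigenspace L μ) (suc d) → μ ≃ q ⊎ μ ≃ 0ᴿ
  basis⇒eigenvalue {μ} = SP.basis⇒eigenvalue *ᴿ-cancel suc×1≄0 ≃0-stable (0-or-suc×1-separate r) {μ}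

  no-eigenvalue : ∀ {μ} → ¬ μ ≃ q → ¬ μ ≃ 0ᴿ → HasDimension (Eigenspace L μ) 0
  no-eigenvalue {μ} = SP.no-eigenvalue *ᴿ-cancel suc×1≄0 ≃0-stable (0-or-suc×1-separate r) {μ}

  eigenspace-resp : ∀ {μ ν d} → μ ≃ ν → HasDimension (Eigenspace L μ) d → HasDimension (Eigenspace L ν) d
  eigenspace-resp {μ} {ν} = HasBasis-resp {M = L} {μ} {ν}

  dimensions-agree : ∀ {μ d e} → HasDimension (Eigenspace L μ) d → HasDimension (Eigenspace L μ) e → d ≡ e
  dimensions-agree {μ} B C = SP.×1-injective *ᴿ-cancel suc×1≄0 (dimension-unique {W = Eigenspace L μ} B C)

  n≡m+mr : n ≡ m + m * r
  n≡m+mr = ≡.trans (↔⇒≡ (↔-trans partition (↔-sym Fin.*↔×))) (ℕ.*-suc m r)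

  m≤n : m ≤ n
  m≤n = ≡.subst (m ≤_) (≡.sym n≡m+mr) (ℕ.m≤m+n m (m * r))

  q≄0 : ∀ {μ} → μ ≃ q → ¬ μ ≃ 0ᴿ
  q≄0 {μ} μ≃q μ≃0 = suc×1≄0 r (≃-trans {q} {μ} {0ᴿ} (≃-sym {μ} {q} μ≃q) μ≃0)

  module _ (0<m : 0 < m) (0<r : 0 < r) where

    0<mr : 0 < m * r
    0<mr = ℕ.*-mono-≤ 0<m 0<r

    ev : Vector ℝ n
    ev i = if does (toℕ i ℕ.<? m) then q else 0ᴿ

    ev-cases : ∀ i → (toℕ i < m × ev i ≡ q) ⊎ (¬ toℕ i < m × ev i ≡ 0ᴿ)
    ev-cases i = decide (toℕ i ℕ.<? m)
      where
      decide : ∀ {P : Set} (P? : Dec P) →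
        (P × (if does P? then q else 0ᴿ) ≡ q) ⊎ (¬ P × (if does P? then q else 0ᴿ) ≡ 0ᴿ)
      decide (yes p) = inj₁ (p , ≡.refl)
      decide (no ¬p) = inj₂ (¬p , ≡.refl)

    ev-sorted : ∀ i j → i Fin.≤ j → ev j ≤ᴿ ev i
    ev-sorted i j i≤j = case ev-cases i , ev-cases j of λ
      { (inj₁ (_ , evᵢ≡q) , inj₁ (_ , evⱼ≡q)) →
          ≡.subst₂ _≤ᴿ_ (≡.sym evⱼ≡q) (≡.sym evᵢ≡q) (≃⇒≤ᴿ {q} {q} (≃-refl {q}))
      ; (inj₁ (_ , evᵢ≡q) , inj₂ (_ , evⱼ≡0)) →
          ≡.subst₂ _≤ᴿ_ (≡.sym evⱼ≡0) (≡.sym evᵢ≡q) (0≤suc×1 r)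
      ; (inj₂ (i≮m , _) , inj₁ (j<m , _)) → ⊥-elim (i≮m (ℕ.≤-<-trans i≤j j<m))
      ; (inj₂ (_ , evᵢ≡0) , inj₂ (_ , evⱼ≡0)) →
          ≡.subst₂ _≤ᴿ_ (≡.sym evⱼ≡0) (≡.sym evᵢ≡0) (≃⇒≤ᴿ {0ᴿ} {0ᴿ} (≃-refl {0ᴿ})) }

    q-multiplicity : HasCardinality (λ i → ev i ≃ q) m
    q-multiplicity = below m , (λ i → mk⇔
      (λ i∈ → case ev-cases i of λ
        { (inj₁ (_ , ev≡q)) → ≡.subst (_≃ q) (≡.sym ev≡q) (≃-refl {q})
        ; (inj₂ (i≮m , _))  → ⊥-elim (i≮m (∈-subsetOf⁻ (λ i → toℕ i ℕ.<? m) i∈)) })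
      (λ ev≃q → case ev-cases i of λ
        { (inj₁ (i<m , _))  → ∈-subsetOf⁺ (λ i → toℕ i ℕ.<? m) i<m
        ; (inj₂ (_ , ev≡0)) → ⊥-elim (q≄0 {ev i} ev≃q (≡.subst (_≃ 0ᴿ) (≡.sym ev≡0) (≃-refl {0ᴿ}))) })) ,
      ∣below∣ m≤n

    0-multiplicity : HasCardinality (λ i → ev i ≃ 0ᴿ) (m * r)
    0-multiplicity = ∁ (below m) , (λ i → mk⇔
      (λ i∈ → case ev-cases i of λ
        { (inj₁ (i<m , _))  → ⊥-elim (x∈∁p⇒x∉p i∈ (∈-subsetOf⁺ (λ i → toℕ i ℕ.<? m) i<m))
        ; (inj₂ (_ , ev≡0)) → ≡.subst (_≃ 0ᴿ) (≡.sym ev≡0) (≃-refl {0ᴿ}) })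
      (λ ev≃0 → case ev-cases i of λ
        { (inj₁ (_ , ev≡q)) → ⊥-elim (q≄0 {ev i} (≡.subst (_≃ q) (≡.sym ev≡q) (≃-refl {q})) ev≃0)
        ; (inj₂ (i≮m , _))  → x∉p⇒x∈∁p (i≮m ∘ ∈-subsetOf⁻ (λ i → toℕ i ℕ.<? m)) })) ,
      ≡.trans (∣∁p∣≡n∸∣p∣ (below {n} m))
        (≡.trans (≡.cong₂ ℕ._∸_ n≡m+mr (∣below∣ m≤n)) (ℕ.m+n∸m≡n m (m * r)))

    -- The positivity of `k` is what later contradicts a zero dimension or an empty index set.
    multiplicity : ∀ {μ} → μ ≃ q ⊎ μ ≃ 0ᴿ → ∃[ k ] 0 < k ×
      HasDimension (Eigenspace L μ) k × HasCardinality (λ i → ev i ≃ μ) k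
    multiplicity {μ} (inj₁ μ≃q) = m , 0<m ,
      eigenspace-resp {q} {μ} (≃-sym {μ} {q} μ≃q) q-eigenspace ,
      HasCardinality-map
        (λ {i} ev≃q → ≃-trans {ev i} {q} {μ} ev≃q (≃-sym {μ} {q} μ≃q))
        (λ {i} ev≃μ → ≃-trans {ev i} {μ} {q} ev≃μ μ≃q) q-multiplicity
    multiplicity {μ} (inj₂ μ≃0) = m * r , 0<mr ,
      eigenspace-resp {0ᴿ} {μ} (≃-sym {μ} {0ᴿ} μ≃0) 0-eigenspace ,
      HasCardinality-map
        (λ {i} ev≃0 → ≃-trans {ev i} {0ᴿ} {μ} ev≃0 (≃-sym {μ} {0ᴿ} μ≃0))
        (λ {i} ev≃μ → ≃-trans {ev i} {μ} {0ᴿ} ev≃μ μ≃0) 0-multiplicity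

    ev≃⇒q-or-0 : ∀ {μ} i → ev i ≃ μ → μ ≃ q ⊎ μ ≃ 0ᴿ
    ev≃⇒q-or-0 {μ} i ev≃μ = case ev-cases i of λ
      { (inj₁ (_ , ev≡q)) → inj₁ (≃-sym {q} {μ} (≡.subst (_≃ μ) ev≡q ev≃μ))
      ; (inj₂ (_ , ev≡0)) → inj₂ (≃-sym {0ᴿ} {μ} (≡.subst (_≃ μ) ev≡0 ev≃μ)) }

    -- A positive `d` locates `μ`, and uniqueness of dimension identifies `d` with the known
    -- multiplicity. For `d` zero, an index with `ev i ≃ μ` would locate `μ` and force a positive
    -- dimension.
    dimension⇒cardinality : ∀ μ d → HasDimension (Eigenspace L μ) d → HasCardinality (λ i → ev i ≃ μ) d
    dimension⇒cardinality μ (suc d) B =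
      let _ , _ , B′ , C = multiplicity {μ} (basis⇒eigenvalue {μ} B)
      in ≡.subst (HasCardinality (λ i → ev i ≃ μ)) (dimensions-agree {μ} B′ B) C
    dimension⇒cardinality μ zero B = HasCardinality-0 λ i ev≃μ →
      let _ , 0<k , B′ , _ = multiplicity {μ} (ev≃⇒q-or-0 {μ} i ev≃μ)
      in ℕ.<-irrefl (dimensions-agree {μ} B B′) 0<k

    -- Whether the index set is inhabited is decidable, being a property of a finite subset. An
    -- index locates `μ`; emptiness excludes both `q` and 0, so that the empty basis spans.
    cardinality⇒dimension : ∀ μ d → HasCardinality (λ i → ev i ≃ μ) d → HasDimension (Eigenspace L μ) d
    cardinality⇒dimension μ d C = case HasCardinality-dichotomy C of λ
      { (inj₁ (i , ev≃μ)) →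
          let _ , _ , B , C′ = multiplicity {μ} (ev≃⇒q-or-0 {μ} i ev≃μ)
          in ≡.subst (HasDimension (Eigenspace L μ)) (HasCardinality-unique C′ C) B
      ; (inj₂ d≡0) →
          let absent : ¬ (μ ≃ q ⊎ μ ≃ 0ᴿ)
              absent μ∈ = let _ , 0<k , _ , C′ = multiplicity {μ} μ∈ in
                ℕ.<-irrefl (≡.trans (≡.sym d≡0) (HasCardinality-unique C C′)) 0<k
          in ≡.subst (HasDimension (Eigenspace L μ)) (≡.sym d≡0)
               (no-eigenvalue {μ} (absent ∘ inj₁) (absent ∘ inj₂)) }

    ev-isEigenvalueList : IsEigenvalueList L ev
    ev-isEigenvalueList = ev-sorted , λ μ d → mk⇔ (dimension⇒cardinality μ d) (cardinality⇒dimension μ d)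

  -- Every entry is `q` or 0. If entry `i` were 0, sortedness would confine the `m` indices of value
  -- `q` to those below `i`, contradicting `toℕ i < m`.
  leading-eigenvalues : ∀ {ev} → IsEigenvalueList L ev → ∀ i → toℕ i < m → ev i ≃ q
  leading-eigenvalues {ev} (sorted , multiplicities) i i<m =
    let S , S⇔q , ∣S∣ = q-card
    in case covered i of λ
      { (inj₁ ev≃q) → ev≃q
      ; (inj₂ ev≃0) → ⊥-elim (ℕ.<⇒≱ i<m (enumeration-≤ (enumerate S ∣S∣)
          (enumerate-below (ℕ.<⇒≤ (Fin.toℕ<n i)))
          λ {j} j∈S → ∈-subsetOf⁺ (λ j → toℕ j ℕ.<? toℕ i) (ℕ.≰⇒> λ i≤j →
            suc×1≰0 r (≤ᴿ-trans {q} {ev j} {0ᴿ}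
              (≃⇒≤ᴿ {q} {ev j} (≃-sym {ev j} {q} (Equivalence.to (S⇔q j) j∈S)))
              (≤ᴿ-trans {ev j} {ev i} {0ᴿ} (sorted i j i≤j) (≃⇒≤ᴿ {ev i} {0ᴿ} ev≃0)))))) }
    where
    q-card : HasCardinality (λ i → ev i ≃ q) m
    q-card = Equivalence.to (multiplicities q m) q-eigenspace
    covered : ∀ i → ev i ≃ q ⊎ ev i ≃ 0ᴿ
    covered = complementary q-card (Equivalence.to (multiplicities 0ᴿ (m * r)) 0-eigenspace) n≡m+mr
      λ {i} → q≄0 {ev i}

  sum-of-eigenvalues : ∀ {ev k} → IsEigenvalueList L ev → k ≤ m → sumFirst k ev ≃ fromℕ (suc r * k)
  sum-of-eigenvalues {ev} {k} ev-list k≤m =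
    ≃-trans {sumFirst k ev} {k ×ᴿ q} {fromℕ (suc r * k)}
      (sumFirst-constant k {q} ev (ℕ.≤-trans k≤m m≤n)
        λ i i<k → leading-eigenvalues {ev} ev-list i (ℕ.<-≤-trans i<k k≤m))
      (≃-trans {k ×ᴿ q} {(k * suc r) ×ᴿ 1ᴿ} {fromℕ (suc r * k)} (×-assocˡ 1ᴿ k (suc r))
        (≡.subst (λ j → (k * suc r) ×ᴿ 1ᴿ ≃ fromℕ j) (ℕ.*-comm k (suc r)) (×1≃fromℕ (k * suc r))))

  k≤m : ∀ {k} → suc r * k ≤ n → k ≤ m
  k≤m {k} rk≤n = ℕ.*-cancelˡ-≤ (suc r) (ℕ.≤-trans rk≤n (ℕ.≤-reflexive
    (≡.trans n≡m+mr (≡.trans (≡.sym (ℕ.*-suc m r)) (ℕ.*-comm m (suc r))))))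

-- The degree sequence and the spectrum of the upper Laplacian

module _ {N : ℕ} (X : SimplicialComplex N) (r : ℕ)
  (unique-coface : ∀ σ → IsFace X r σ → ∃! _≡_ (λ τ → IsFace X (suc r) τ × σ ⊆ τ)) where

  open UniqueCoface X r unique-coface

  degrees-all-1 : All (_≡ 1) (degrees X r)
  degrees-all-1 = ↭.All-resp-↭ (↭.↭-sym (Sort.sort-↭ _ (map (deg X r) (faces X r))))
    (All.map⁺ (All.tabulate λ σ∈ → deg≡1 (faces-∈ X σ∈)))

  length-degrees : length (degrees X r) ≡ n
  length-degrees = ≡.trans (↭.↭-length (Sort.sort-↭ _ (map (deg X r) (faces X r))))
    (List.length-map (deg X r) (faces X r))

  sum-of-degrees : ∀ {j} → j ≤ n → j ≡ sum (take j (degrees X r))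
  sum-of-degrees {j} j≤n = ≡.sym (sum-take-ones j (≡.subst (j ≤_) (≡.sym length-degrees) j≤n) degrees-all-1)

  module _ {_≺_ : Rel (Fin N) 0ℓ} (≺-sto : IsStrictTotalOrder _≡_ _≺_) where

    weight : Fin n → ℝ
    weight i = fromℤ (sign ≺-sto i)

    weight² : ∀ i → weight i *ᴿ weight i ≃ 1ᴿ
    weight² i = ≗⇒≃ {weight i *ᴿ weight i} {1ᴿ} (fromℤ-sign-square (sign-isSign ≺-sto i))

    laplacian-δ : ∀ i j → upperLaplacian ≺-sto X r i j ≃ δ (coface i) (coface j) *ᴿ (weight i *ᴿ weight j)
    laplacian-δ i j =
      ≗⇒≃ {upperLaplacian ≺-sto X r i j} {δ (coface i) (coface j) *ᴿ (weight i *ᴿ weight j)}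
      λ k → ≡.trans (≡.cong (λ z → seq (fromℤ z) k) (laplacian-entry ≺-sto i j))
        (fromℤ-sign-entry (does (coface i Fin.≟ coface j)) (sign-isSign ≺-sto i) (sign-isSign ≺-sto j) k)

    laplacian-spectrum : ∀ k → 1 ≤ k → suc r * k ≤ n → 1 ≤ r →
      ∃ (IsEigenvalueList (upperLaplacian ≺-sto X r)) ×
      (∀ ev → IsEigenvalueList (upperLaplacian ≺-sto X r) ev → sumFirst k ev ≃ fromℕ (suc r * k))
    laplacian-spectrum k 1≤k rk≤n 1≤r =
      (ev 0<m 1≤r , ev-isEigenvalueList 0<m 1≤r) ,
      λ ev ev-list → sum-of-eigenvalues {ev} ev-list (k≤m rk≤n)
      where
      open Spectrum partition weight weight² (upperLaplacian ≺-sto X r) laplacian-δ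
      0<m : 0 < m
      -- The list has `(r + 1) m` entries, so the bound on `k` gives `k ≤ m`, and a positive `k`
      -- yields at least one coface.
      0<m = ℕ.≤-trans 1≤k (k≤m rk≤n)

proposition3p5 : ∀ {N : ℕ} {_≺_ : Rel (Fin N) 0ℓ} (≺-sto : IsStrictTotalOrder _≡_ _≺_)
    (X : SimplicialComplex N) (r : ℕ) → 1 ≤ r →
    (∀ σ → IsFace X r σ → ∃! _≡_ (λ τ → IsFace X (r + 1) τ × σ ⊆ τ)) →
    ∀ (k : ℕ) → 1 ≤ k → (r + 1) * k ≤ f X r →
    ∃ (IsEigenvalueList (upperLaplacian ≺-sto X r)) ×
    (∀ ev → IsEigenvalueList (upperLaplacian ≺-sto X r) ev →
    sumFirst k ev ≃ fromℕ ((r + 1) * k)) ×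
    (r + 1) * k ≡ sum (take ((r + 1) * k) (degrees X r))
proposition3p5 {N} ≺-sto X r 1≤r unique-coface k 1≤k rk≤n =
  ≡.subst Goal (≡.sym r+1≡) (eigenvalues , sums , sum-of-degrees X r unique-coface′ rk≤n′)
  where
  r+1≡ : r + 1 ≡ suc r
  r+1≡ = ℕ.+-comm r 1
  Goal : ℕ → Set
  Goal s = ∃ (IsEigenvalueList (upperLaplacian ≺-sto X r)) ×
    (∀ ev → IsEigenvalueList (upperLaplacian ≺-sto X r) ev → sumFirst k ev ≃ fromℕ (s * k)) ×
    s * k ≡ sum (take (s * k) (degrees X r))
  unique-coface′ : ∀ σ → IsFace X r σ → ∃! _≡_ (λ τ → IsFace X (suc r) τ × σ ⊆ τ)
  unique-coface′ = ≡.subst (λ s → ∀ σ → IsFace X r σ → ∃! _≡_ (λ τ → IsFace X s τ × σ ⊆ τ)) r+1≡ unique-coface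
  rk≤n′ : suc r * k ≤ f X r
  rk≤n′ = ≡.subst (λ s → s * k ≤ f X r) r+1≡ rk≤n
  spectrum = laplacian-spectrum X r unique-coface′ ≺-sto k 1≤k rk≤n′ 1≤r
  eigenvalues = proj₁ spectrum
  sums        = proj₂ spectrum
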